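{- Given a deterministic distributed algorithm $\mathcal{A}$ that computes a maximal matching in $N$-vertex hypergraphs of rank $3$ and maximum degree $d$ in $T(N,d)$ rounds, there is a deterministic distributed algorithm $\mathcal{B}$ that solves list-edge-coloring of any $n$-node graph $G=(V,E)$ with maximum degree $\Delta$ in at most $T(2n\Delta^2,\,2\Delta-1)$ rounds. In the list-edge-coloring problem, each edge $e$ must choose its color from an arbitrary given list $L_e$ of colors with $|L_e|=d_e+1$, where $d_e$ denotes the number of edges adjacent to $e$.
   Context: All algorithms are in the LOCAL model: nodes of the (hyper)graph have unique identifiers of logarithmic length and initially know only their neighbors and incident (hyper)edges (and, for list-edge-coloring, the lists of their incident edges). Communication proceeds in synchronous rounds; in each round each node can send a message of arbitrary size on each of its (hyper)edges, which is delivered to all other endpoints of that (hyper)edge. At the end each node must know its own part of the solution (the matching hyperedges among its hyperedges, or the colors of its edges). The rank of a hypergraph is the maximum number of vertices in any of its hyperedges; the degree of a vertex is the number of hyperedges containing it. A matching in a hypergraph is a set of hyperedges no two of which share a vertex; it is maximal if no hyperedge can be added to it. Two edges of a graph are adjacent if they are distinct and share an endpoint; in an edge-coloring, adjacent edges must get different colors. -}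

module Defs where

open import Data.Bool.Base using (Bool; if_then_else_)
open import Data.Fin.Base using (Fin)
open import Data.Fin.Properties using (_≟_)
open import Data.Fin.Subset using (Subset; _∈_; _∉_; _∩_; _∪_; ⁅_⁆; ∣_∣; Nonempty)
open import Data.Fin.Subset.Properties using (_∈?_; nonempty?)
open import Data.List.Base using (List; []; _∷_; map; filter; length; tabulate; allFin)
open import Data.List.Extrema.Nat using (max)
import Data.List.Membership.Propositional as List
open import Data.List.Relation.Unary.Unique.Propositional using (Unique)
open import Data.Maybe.Base using (Maybe; just; _<∣>_)
open import Data.Nat.Base using (ℕ; zero; suc; _*_; _≤_)
open import Data.Nat.Logarithm using (⌈log₂_⌉)
open import Data.Product.Base using (Σ-syntax; ∃-syntax; _×_; _,_)
open import Data.Unit.Base using (⊤; tt)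
open import Data.Vec.Base using (lookup)
open import Function.Bundles using (_⇔_)
open import Function.Definitions using (Injective)
open import Relation.Binary.PropositionalEquality using (_≡_; _≢_)
open import Relation.Nullary using (Dec; ¬_; does; ¬?; _×-dec_)

------------------------------------------------------------------------
-- Hypergraphs

record Hypergraph (n : ℕ) : Set where
  field
    size     : ℕ
    edge     : Fin size → Subset n
    nonempty : ∀ e → Nonempty (edge e)
    distinct : Injective _≡_ _≡_ edge

  rank : ℕ
  rank = max 0 (tabulate λ e → ∣ edge e ∣)

  degree : Fin n → ℕ
  degree v = length (filter (λ e → v ∈? edge e) (allFin size))

  maxDegree : ℕ
  maxDegree = max 0 (tabulate degree)

  ShareVertex : Fin size → Fin size → Set
  ShareVertex e f = Nonempty (edge e ∩ edge f)

  Adjacent : Fin size → Fin size → Set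
  Adjacent e f = e ≢ f × ShareVertex e f

  adjacent? : ∀ e f → Dec (Adjacent e f)
  adjacent? e f = ¬? (e ≟ f) ×-dec nonempty? (edge e ∩ edge f)

  edgeDegree : Fin size → ℕ
  edgeDegree e = length (filter (adjacent? e) (allFin size))

  Neighbors : Fin n → Fin n → Set
  Neighbors v w = v ≢ w × ∃[ e ] (v ∈ edge e × w ∈ edge e)

  Matching : Subset size → Set
  Matching M = ∀ {e f} → e ∈ M → f ∈ M → e ≢ f → ¬ ShareVertex e f

  MaximalMatching : Subset size → Set
  MaximalMatching M = Matching M × (∀ e → e ∉ M → ¬ Matching (M ∪ ⁅ e ⁆))

-- Hyperedges are pairwise distinct sets, so the 2-uniform hypergraphs are
-- exactly the simple graphs.
IsGraph : ∀ {n} → Hypergraph n → Set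
IsGraph G = ∀ e → ∣ edge e ∣ ≡ 2
  where open Hypergraph G

------------------------------------------------------------------------
-- The LOCAL model

bitLength : ℕ → ℕ
bitLength i = ⌈log₂ suc i ⌉

-- A hypergraph as a communication network.  The number κ is the constant in
-- "identifiers of O(log n) bits".  Each node refers to its hyperedges and to
-- its neighbors through local enumerations of them, which are arbitrary.
record Network (κ : ℕ) {n : ℕ} (H : Hypergraph n) : Set where
  open Hypergraph H
  field
    identifier        : Fin n → ℕ
    identifier-unique : Injective _≡_ _≡_ identifier
    identifier-length : ∀ v → bitLength (identifier v) ≤ κ * ⌈log₂ n ⌉

    incident          : Fin n → List (Fin size)
    incident-unique   : ∀ v → Unique (incident v)
    incident-complete : ∀ v e → e List.∈ incident v ⇔ v ∈ edge e

    neighbors          : Fin n → List (Fin n)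
    neighbors-unique   : ∀ v → Unique (neighbors v)
    neighbors-complete : ∀ v w → w List.∈ neighbors v ⇔ Neighbors v w

  -- The endpoints of e other than v, in the order in which v enumerates them.
  others : Fin n → Fin size → List (Fin n)
  others v e = filter (λ w → w ∈? edge e) (neighbors v)

-- What a node knows initially: its own identifier and, for each incident
-- hyperedge, the local input of that hyperedge and which of the neighbors
-- (given by their indices in the local enumeration of neighbors) are its
-- other endpoints.  The identifiers of the neighbors are not included; they
-- have to be communicated.
record LocalView (I : Set) : Set where
  constructor localView
  field
    identifier : ℕ
    incident   : List (I × List ℕ)

-- A deterministic algorithm run by every node, with an input from I and an
-- output in O for each hyperedge.  No node is told n or the maximum degree.
-- Incident hyperedges are addressed by their local indices.  The received
-- messages are listed per incident hyperedge, one from each other endpoint,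
-- and the output lists one value per incident hyperedge.
record Algorithm (I O : Set) : Set₁ where
  field
    State   : Set
    Message : Set
    init    : LocalView I → State
    send    : State → ℕ → Message
    receive : State → List (List Message) → State
    output  : State → Maybe (List O)

-- Index of the first occurrence.
position : ∀ {k} → Fin k → List (Fin k) → ℕ
position x []       = 0
position x (y ∷ ys) = if does (x ≟ y) then 0 else suc (position x ys)

module Execution {I O : Set} (𝒜 : Algorithm I O)
                 {κ n : ℕ} {H : Hypergraph n} (net : Network κ H)
                 (input : Fin (Hypergraph.size H) → I) where
  open Hypergraph H
  open Network net
  open Algorithm 𝒜

  view : Fin n → LocalView I
  view v = localView (identifier v)
    (map (λ e → input e , map (λ w → position w (neighbors v)) (others v e))
         (incident v))

  inbox : (Fin n → State) → Fin n → List (List Message)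
  inbox s v =
    map (λ e → map (λ w → send (s w) (position e (incident w))) (others v e))
        (incident v)

  state : ℕ → Fin n → State
  state zero    v = init (view v)
  state (suc t) v = receive (state t v) (inbox (state t) v)

  -- The first output a node produces within t rounds; it is final, although
  -- the node may go on relaying messages.
  decision : ℕ → Fin n → Maybe (List O)
  decision zero    v = output (state zero v)
  decision (suc t) v = decision t v <∣> output (state (suc t) v)

  -- Within t rounds, every node knows its own part of the given solution.
  OutputsWithin : ℕ → (Fin size → O) → Set
  OutputsWithin t solution =
    ∀ v → decision t v ≡ just (map solution (incident v))

------------------------------------------------------------------------
-- The two problems

ComputesMaximalMatching : (κ : ℕ) → Algorithm ⊤ Bool → (N r d t : ℕ) → Set
ComputesMaximalMatching κ 𝒜 N r d t =
  (H : Hypergraph N) → Hypergraph.rank H ≡ r → Hypergraph.maxDegree H ≡ d →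
  (net : Network κ H) →
  let open Hypergraph H
      open Execution 𝒜 net (λ _ → tt)
  in Σ[ M ∈ Subset size ] (MaximalMatching M × OutputsWithin t (lookup M))

record ListAssignment {n : ℕ} (G : Hypergraph n) : Set where
  open Hypergraph G
  field
    colors          : Fin size → List ℕ
    colors-distinct : ∀ e → Unique (colors e)
    colors-length   : ∀ e → length (colors e) ≡ suc (edgeDegree e)

  ListEdgeColoring : (Fin size → ℕ) → Set
  ListEdgeColoring φ = (∀ e → φ e List.∈ colors e)
                     × (∀ {e f} → Adjacent e f → φ e ≢ φ f)

SolvesListEdgeColoring : (κ : ℕ) → Algorithm (List ℕ) ℕ → (n Δ t : ℕ) → Set
SolvesListEdgeColoring κ ℬ n Δ t =
  (G : Hypergraph n) → IsGraph G → Hypergraph.maxDegree G ≡ Δ →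
  (L : ListAssignment G) (net : Network κ G) →
  let open Hypergraph G
      open ListAssignment L
      open Execution ℬ net colors
  in Σ[ φ ∈ (Fin size → ℕ) ] (ListEdgeColoring φ × OutputsWithin t φ)

{-# OPTIONS --safe #-}

-- Let H have a vertex for every edge e of G and a vertex (u , c) for every node u
-- and every color c available to some edge at u, and let it have, for every edge
-- e = {u , v} and every c in L_e, the hyperedge {e , (u , c) , (v , c)}.  A
-- matching of H picks at most one color for each edge and never the same color for
-- adjacent edges.  If it is maximal and picks no color for e, then each of the
-- d_e + 1 colors of e has been picked for an edge adjacent to e, and distinct
-- colors for distinct edges, which is impossible.  Isolated vertices and, if no
-- list has 2Δ − 1 colors, a disjoint star give H exactly 2nΔ² vertices and maximum
-- degree 2Δ − 1.
--
-- The node u runs all vertices (u , c), and both endpoints of e run the vertex e.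
-- This costs no additional round: the output of u depends only on the vertices
-- (u , c), whose first messages do not involve any other node, and what u needs to
-- start the vertex e, namely the identifier of the other endpoint, arrives in time
-- for the first update.

module Submission where

open import Defs
open import Data.Bool.Base using (Bool; true; false; if_then_else_)
import Data.Bool.Properties as Bool
open import Data.Empty using (⊥; ⊥-elim)
open import Data.Fin.Base as Fin using (Fin; zero; suc; toℕ; _↑ˡ_; _↑ʳ_)
import Data.Fin.Properties as Fin
open import Data.Fin.Subset as Subset using (Subset; ∣_∣; ⁅_⁆; _∪_) renaming (_∈_ to _∈ˢ_)
import Data.Fin.Subset.Properties as Subset
open import Data.List.Base hiding (find)
open import Data.List.Extrema.Nat using (max; max≤v⁺; v≤max⁺)
open import Data.List.Membership.Propositional using (_∈_; _∉_; find)
open import Data.List.Membership.Propositional.Properties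
open import Data.List.Properties
open import Data.List.Relation.Unary.All as All using (All; []; _∷_)
import Data.List.Relation.Unary.All.Properties as All
open import Data.List.Relation.Unary.AllPairs using ([]; _∷_)
open import Data.List.Relation.Unary.Any as Any using (Any; here; there)
import Data.List.Relation.Unary.Any.Properties as Any
open import Data.List.Relation.Unary.Unique.Propositional using (Unique)
import Data.List.Relation.Unary.Unique.Propositional.Properties as Unique
open import Data.Maybe.Base using (Maybe; just; nothing; _<∣>_; maybe′; is-just)
open import Data.Maybe.Properties using (just-injective)
open import Data.Nat.Base
open import Data.Nat.Induction using (<-rec)
open import Data.Nat.Logarithm as Log using (⌈log₂_⌉)
import Data.Nat.Properties as ℕ
open import Data.Nat.Solver using (module +-*-Solver)
open import Data.Product.Base using (Σ; Σ-syntax; ∃-syntax; _×_; _,_; proj₁; proj₂)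
open import Data.Sum.Base as Sum using (_⊎_; inj₁; inj₂)
open import Data.Sum.Function.Propositional using (_⊎-↔_)
open import Data.Unit.Base using (⊤; tt)
import Data.Vec.Base as Vec
import Data.Vec.Properties as Vec
open import Function.Base using (_∘_; id; case_of_)
open import Function.Bundles using (_⇔_; Equivalence; _↔_; Inverse; mk⇔; mk↔ₛ′)
open import Function.Properties.Inverse using (↔-refl; ↔-sym; ↔-trans)
open import Relation.Binary.Definitions using (tri<; tri≈; tri>)
open import Relation.Binary.PropositionalEquality
open import Relation.Nullary
open import Relation.Nullary.Decidable using (dec-true; dec-false)
open import Relation.Unary using (Decidable)
open import Data.List.Membership.DecPropositional ℕ._≟_ using (_∈?_)
open import Data.List.Relation.Unary.Unique.DecPropositional.Properties using (deduplicate-!)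
open Equivalence using (to; from)

-- The running time of 𝒜 is assumed only for hypergraphs that have exactly the given number of
-- vertices and exactly the given maximum degree, and `T` is an arbitrary function, not a monotone
-- one. So these parameters have to be met with equality, although no node of G is told n or Δ. No
-- node runs the padding: it forms components of its own, and 𝒜 at a vertex depends only on what the
-- component of that vertex sends. The obstacle is that all that 𝒜 sees at a vertex, namely
-- identifier, ports and order of messages, has to be computable by the nodes that run it. Three
-- choices achieve this. Colors can be arbitrarily large numbers, so the identifier of (u , c)
-- contains the index of c among the colors at u instead of c. The endpoints of e are ordered by
-- identifier, so both runs of the vertex e agree. The neighbors of a vertex of H are enumerated
-- hyperedge by hyperedge, so a local view reveals nothing but the identifier and the sizes of the
-- hyperedges.

private
  variable
    A B : Set
    n : ℕ

-- Lists

lookup-injective : {xs : List A} → Unique xs → ∀ {i j} → lookup xs i ≡ lookup xs j → i ≡ j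
lookup-injective (_ ∷ _)  {zero}  {zero}  _  = refl
lookup-injective (x∉ ∷ _) {zero}  {suc j} eq = ⊥-elim (All.lookup x∉ (∈-lookup j) eq)
lookup-injective (x∉ ∷ _) {suc i} {zero}  eq = ⊥-elim (All.lookup x∉ (∈-lookup i) (sym eq))
lookup-injective (_ ∷ u)  {suc i} {suc j} eq = cong suc (lookup-injective u eq)

length-mono-⊆ : {xs ys : List A} → Unique xs → (∀ {x} → x ∈ xs → x ∈ ys) → length xs ≤ length ys
length-mono-⊆ {xs = xs} {ys} u ⊆ys =
    Fin.injective⇒≤ {f = λ i → Any.index (⊆ys (∈-lookup {xs = xs} i))} λ {i} {j} eq →
  lookup-injective u (trans (Any.lookup-index (⊆ys (∈-lookup i)))
    (trans (cong (lookup ys) eq) (sym (Any.lookup-index (⊆ys (∈-lookup j))))))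

length-unique : {xs ys : List A} → Unique xs → Unique ys → (∀ {x} → x ∈ xs ⇔ x ∈ ys) → length xs ≡ length ys
length-unique uxs uys eq = ℕ.≤-antisym (length-mono-⊆ uxs (to eq)) (length-mono-⊆ uys (from eq))

unique-singleton : {xs : List A} {a : A} → Unique xs → (∀ {x} → x ∈ xs ⇔ x ≡ a) → xs ≡ a ∷ []
unique-singleton {xs = []}          u        eq with () ← from eq refl
unique-singleton {xs = x ∷ []}      u        eq = cong (_∷ []) (to eq (here refl))
unique-singleton {xs = x ∷ y ∷ xs} ((x≢y ∷ _) ∷ _) eq =
  ⊥-elim (x≢y (trans (to eq (here refl)) (sym (to eq (there (here refl))))))

filter-map : {P : B → Set} (P? : Decidable P) (f : A → B) (xs : List A) →
             filter P? (map f xs) ≡ map f (filter (P? ∘ f) xs)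
filter-map P? f [] = refl
filter-map P? f (x ∷ xs) with does (P? (f x))
... | true  = cong (f x ∷_) (filter-map P? f xs)
... | false = filter-map P? f xs

filter-concatMap : {P : B → Set} (P? : Decidable P) (f : A → List B) {x : A} {xs : List A} → Unique xs →
    x ∈ xs →
                   (∀ {y} → y ∈ f x → P y) → (∀ {x′ y} → x′ ∈ xs → x′ ≢ x → y ∈ f x′ → ¬ P y) →
                   filter P? (concatMap f xs) ≡ f x
filter-concatMap P? f {xs = x ∷ xs} (x∉ ∷ u) (here refl) all-x none =
  trans (filter-++ P? (f x) (concatMap f xs))
    (trans (cong₂ _++_ (filter-all P? (All.tabulate all-x)) (filter-none P? (All.tabulate rest)))
        (++-identityʳ (f x)))
  where
  rest : ∀ {y} → y ∈ concatMap f xs → ¬ _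
  rest y∈ with x′ , x′∈ , y∈x′ ← find (∈-concatMap⁻ f {xs} y∈) =
      none (there x′∈) (≢-sym (All.lookup x∉ x′∈)) y∈x′
filter-concatMap P? f {xs = z ∷ xs} (x∉ ∷ u) (there x∈) all-x none =
  trans (filter-++ P? (f z) (concatMap f xs))
    (cong₂ _++_ (filter-none P? (All.tabulate (none (here refl) (All.lookup x∉ x∈))))
      (filter-concatMap P? f u x∈ all-x (none ∘ there)))

unique-concatMap : (f : A → List B) {xs : List A} → Unique xs → (∀ {x} → x ∈ xs → Unique (f x)) →
                   (∀ {x x′ y} → x ∈ xs → x′ ∈ xs → y ∈ f x → y ∈ f x′ → x ≡ x′) → Unique (concatMap f xs)
unique-concatMap f [] _ _ = []
unique-concatMap f {x ∷ xs} (x∉ ∷ u) uf disj =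
  Unique.++⁺ (uf (here refl)) (unique-concatMap f u (uf ∘ there) λ p q → disj (there p) (there q))
    λ (y∈ , y∈′) → let x′ , x′∈ , y∈x′ = find (∈-concatMap⁻ f {xs} y∈′) in
      All.lookup x∉ x′∈ (disj (here refl) (there x′∈) y∈ y∈x′)

-- Positions

at : A → List A → ℕ → A
at d []       _       = d
at d (x ∷ _)  zero    = x
at d (_ ∷ xs) (suc i) = at d xs i

position-here : (x : Fin n) (xs : List (Fin n)) → position x (x ∷ xs) ≡ 0
position-here x xs with x Fin.≟ x
... | yes _  = refl
... | no x≢x = ⊥-elim (x≢x refl)

position-there : {x y : Fin n} (xs : List (Fin n)) → x ≢ y → position x (y ∷ xs) ≡ suc (position x xs)
position-there {x = x} {y} xs x≢y with x Fin.≟ y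
... | yes x≡y = ⊥-elim (x≢y x≡y)
... | no _    = refl

position-++ : {x : Fin n} {xs ys : List (Fin n)} → x ∉ xs → position x (xs ++ x ∷ ys) ≡ length xs
position-++ {x = x} {[]}     {ys} _  = position-here x ys
position-++ {x = x} {z ∷ xs} {ys} x∉ =
  trans (position-there (xs ++ x ∷ ys) (x∉ ∘ here)) (cong suc (position-++ (x∉ ∘ there)))

at-position : (d : B) (f : Fin n → B) {x : Fin n} {xs : List (Fin n)} → x ∈ xs →
              at d (map f xs) (position x xs) ≡ f x
at-position d f {x} {y ∷ xs} x∈ with x Fin.≟ y
at-position d f x∈          | yes refl = refl
at-position d f (here x≡y)  | no x≢y   = ⊥-elim (x≢y x≡y)
at-position d f (there x∈)  | no _     = at-position d f x∈

consecutive : ℕ → ℕ → List ℕ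
consecutive a zero    = []
consecutive a (suc l) = a ∷ consecutive (suc a) l

-- The indices that arise when neighbors are enumerated block by block. They depend on the block
-- lengths only, so they can be computed without knowing the neighbors.
segments : ℕ → List ℕ → List (List ℕ)
segments a []       = []
segments a (l ∷ ls) = consecutive a l ∷ segments (a + l) ls

-- `ys` collects what the induction has passed. Since nothing repeats, the first occurrence of an
-- element is the one inside its own block.
positions-consecutive : (ys xs zs : List (Fin n)) → Unique (ys ++ xs ++ zs) →
                        map (λ x → position x (ys ++ xs ++ zs)) xs ≡ consecutive (length ys) (length xs)
positions-consecutive ys []       zs u = refl
positions-consecutive ys (x ∷ xs) zs u = cong₂ _∷_ (position-++ (x∉ ys u)) rest
  where
  x∉ : ∀ ys {zs} → Unique (ys ++ x ∷ zs) → x ∉ ys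
  x∉ (y ∷ ys) (y∉ ∷ u) (here refl) = All.lookup y∉ (∈-insert ys) refl
  x∉ (y ∷ ys) (y∉ ∷ u) (there x∈)  = x∉ ys u x∈
  shift : ys ++ x ∷ xs ++ zs ≡ (ys ++ x ∷ []) ++ xs ++ zs
  shift = sym (++-assoc ys (x ∷ []) (xs ++ zs))
  rest : map (λ x′ → position x′ (ys ++ x ∷ xs ++ zs)) xs ≡ consecutive (suc (length ys)) (length xs)
  rest = trans (map-cong (λ x′ → cong (position x′) shift) xs)
    (trans (positions-consecutive (ys ++ x ∷ []) xs zs (subst Unique shift u))
      (cong (λ a → consecutive a (length xs)) (trans (length-++ ys) (ℕ.+-comm (length ys) 1))))

positions-segments : (ys : List (Fin n)) (xss : List (List (Fin n))) → Unique (ys ++ concat xss) →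
                     map (map (λ x → position x (ys ++ concat xss))) xss ≡ segments (length ys) (map length xss)
positions-segments ys []         u = refl
positions-segments ys (xs ∷ xss) u = cong₂ _∷_ (positions-consecutive ys xs (concat xss) u)
  (trans (map-cong (map-cong λ x → cong (position x) shift) xss)
    (trans (positions-segments (ys ++ xs) xss (subst Unique shift u))
      (cong (λ a → segments a (map length xss)) (length-++ ys))))
  where
  shift : ys ++ xs ++ concat xss ≡ (ys ++ xs) ++ concat xss
  shift = sym (++-assoc ys xs (concat xss))

-- Subsets

fromList : List (Fin n) → Subset n
fromList = foldr (λ x S → ⁅ x ⁆ ∪ S) Subset.⊥

∈-fromList : {x : Fin n} {xs : List (Fin n)} → x ∈ˢ fromList xs ⇔ x ∈ xs
∈-fromList = mk⇔ (⇒ _) ⇐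
  where
  ⇒ : ∀ xs {x : Fin n} → x ∈ˢ fromList xs → x ∈ xs
  ⇒ []       x∈ = ⊥-elim (Subset.∉⊥ x∈)
  ⇒ (y ∷ xs) x∈ with Subset.x∈p∪q⁻ ⁅ y ⁆ (fromList xs) x∈
  ... | inj₁ x∈y  = here (Subset.x∈⁅y⁆⇒x≡y y x∈y)
  ... | inj₂ x∈xs = there (⇒ xs x∈xs)
  ⇐ : ∀ {x : Fin n} {xs} → x ∈ xs → x ∈ˢ fromList xs
  ⇐ (here refl) = Subset.x∈p∪q⁺ (inj₁ (Subset.x∈⁅x⁆ _))
  ⇐ (there x∈)  = Subset.x∈p∪q⁺ (inj₂ (⇐ x∈))

elements : Subset n → List (Fin n)
elements {n} S = filter (Subset._∈? S) (allFin n)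

elements-unique : (S : Subset n) → Unique (elements S)
elements-unique S = Unique.filter⁺ (Subset._∈? S) (Unique.allFin⁺ _)

∈-elements : {S : Subset n} {x : Fin n} → x ∈ elements S ⇔ x ∈ˢ S
∈-elements {S = S} = mk⇔ (λ x∈ → proj₂ (∈-filter⁻ (Subset._∈? S) {xs = allFin _} x∈))
    (λ x∈ → ∈-filter⁺ (Subset._∈? S) (∈-allFin _) x∈)

length-elements : (S : Subset n) → length (elements S) ≡ ∣ S ∣
length-elements-tail : ∀ b (S : Subset n) → length (filter (Subset._∈? (b Vec.∷ S)) (tabulate suc)) ≡ ∣ S ∣

length-elements Vec.[] = refl
length-elements {suc n} (true Vec.∷ S) = cong suc (length-elements-tail true S)
length-elements {suc n} (false Vec.∷ S) = length-elements-tail false S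

length-elements-tail {n} b S =
  trans (cong (length ∘ filter (Subset._∈? (b Vec.∷ S))) (sym (map-tabulate id suc)))
    (trans (cong length (filter-map (Subset._∈? (b Vec.∷ S)) suc (allFin n)))
      (trans (length-map Fin.suc (filter ((Subset._∈? (b Vec.∷ S)) ∘ suc) (allFin n)))
        (trans (cong length (filter-≐ ((Subset._∈? (b Vec.∷ S)) ∘ suc) (Subset._∈? S)
            (Subset.drop-there , Vec.there) (allFin n)))
          (length-elements S))))

∣∣-unique : {S : Subset n} {xs : List (Fin n)} → Unique xs → (∀ {x} → x ∈ˢ S ⇔ x ∈ xs) → ∣ S ∣ ≡ length xs
∣∣-unique {S = S} u eq = trans (sym (length-elements S)) (length-unique (elements-unique S) u
  (mk⇔ (to eq ∘ to ∈-elements) (from ∈-elements ∘ from eq)))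

-- Finite sums

total : ∀ {m} → (Fin m → ℕ) → ℕ
total {zero}  f = 0
total {suc m} f = f zero + total (f ∘ suc)

total-≤ : ∀ {m} {f : Fin m → ℕ} {b} → (∀ i → f i ≤ b) → total f ≤ m * b
total-≤ {zero}  f≤b = z≤n
total-≤ {suc m} f≤b = ℕ.+-mono-≤ (f≤b zero) (total-≤ (f≤b ∘ suc))

Σ↔ : ∀ {m} (f : Fin m → ℕ) → Σ (Fin m) (Fin ∘ f) ↔ Fin (total f)
Σ↔ f = mk↔ₛ′ (encode f) (decode f) (encode∘decode f) (decode∘encode f)
  where
  Sigma : ∀ {m} → (Fin m → ℕ) → Set
  Sigma {m} f = Σ (Fin m) (Fin ∘ f)
  encode : ∀ {m} (f : Fin m → ℕ) → Sigma f → Fin (total f)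
  encode f (zero  , j) = j ↑ˡ total (f ∘ suc)
  encode f (suc i , j) = f zero ↑ʳ encode (f ∘ suc) (i , j)
  next : ∀ {m} {f : Fin (suc m) → ℕ} → Sigma (f ∘ suc) → Sigma f
  next (i , j) = suc i , j
  collect : ∀ {m} (f : Fin (suc m) → ℕ) → Fin (f zero) ⊎ Sigma (f ∘ suc) → Sigma f
  collect f (inj₁ j) = zero , j
  collect f (inj₂ p) = next p
  decode : ∀ {m} (f : Fin m → ℕ) → Fin (total f) → Sigma f
  decode {suc m} f k = collect f (Sum.map₂ (decode (f ∘ suc)) (Fin.splitAt (f zero) k))
  decode∘encode : ∀ {m} (f : Fin m → ℕ) p → decode f (encode f p) ≡ p
  decode∘encode f (zero , j) rewrite Fin.splitAt-↑ˡ (f zero) j (total (f ∘ suc)) = refl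
  decode∘encode f (suc i , j) rewrite Fin.splitAt-↑ʳ (f zero) (total (f ∘ suc)) (encode (f ∘ suc) (i , j)) =
    cong next (decode∘encode (f ∘ suc) (i , j))
  encode∘decode : ∀ {m} (f : Fin m → ℕ) k → encode f (decode f k) ≡ k
  encode∘decode {suc m} f k = trans (split (Fin.splitAt (f zero) k)) (Fin.join-splitAt (f zero) _ k)
    where
    split : ∀ x → encode f (collect f (Sum.map₂ (decode (f ∘ suc)) x)) ≡ Fin.join (f zero) _ x
    split (inj₁ j) = refl
    split (inj₂ l) = cong (f zero ↑ʳ_) (encode∘decode (f ∘ suc) l)

-- Identifiers of logarithmic length

-- Arguments of sum s give values from s² to s² + s, below (s + 1)², so the value determines s and
-- then a. As the growth is quadratic, the bit length doubles up to a constant, which keeps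
-- identifiers logarithmic.
pair : ℕ → ℕ → ℕ
pair a b = (a + b) * (a + b) + a

pair<[1+sum]² : ∀ a b → pair a b < suc (a + b) * suc (a + b)
pair<[1+sum]² a b = s≤s (begin
  (a + b) * (a + b) + a                       ≤⟨ ℕ.+-monoʳ-≤ ((a + b) * (a + b)) (ℕ.m≤m+n a b) ⟩
  (a + b) * (a + b) + (a + b)                 ≡⟨ ℕ.+-comm ((a + b) * (a + b)) (a + b) ⟩
  (a + b) + (a + b) * (a + b)                 ≡⟨ ℕ.*-suc (a + b) (a + b) ⟨
  (a + b) * suc (a + b)                       ≤⟨ ℕ.m≤n+m _ (a + b) ⟩
  (a + b) + (a + b) * suc (a + b)             ∎)
  where open ℕ.≤-Reasoning

pair-injective : ∀ {a b c d} → pair a b ≡ pair c d → a ≡ c × b ≡ d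
pair-injective {a} {b} {c} {d} eq = a≡c , ℕ.+-cancelˡ-≡ a b d (trans sum≡ (cong (_+ d) (sym a≡c)))
  where
  sum≮ : ∀ {a b c d} → pair a b ≡ pair c d → ¬ a + b < c + d
  sum≮ {a} {b} {c} {d} eq lt = ℕ.<-irrefl eq (ℕ.<-≤-trans (pair<[1+sum]² a b)
    (ℕ.≤-trans (ℕ.*-mono-≤ lt lt) (ℕ.m≤m+n ((c + d) * (c + d)) c)))
  sum≡ : a + b ≡ c + d
  sum≡ = ℕ.≤-antisym (ℕ.≮⇒≥ (sum≮ {c} {d} {a} {b} (sym eq))) (ℕ.≮⇒≥ (sum≮ {a} {b} {c} {d} eq))
  a≡c : a ≡ c
  a≡c = ℕ.+-cancelˡ-≡ ((a + b) * (a + b)) a c (trans eq (cong (λ s → s * s + c) (sym sum≡)))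

pair<2^ : ∀ k {a b} → a < 2 ^ k → b < 2 ^ k → pair a b < 2 ^ (2 * suc k)
pair<2^ k {a} {b} a< b< = begin-strict
  pair a b                           <⟨ pair<[1+sum]² a b ⟩
  suc (a + b) * suc (a + b)          ≤⟨ ℕ.*-mono-≤ sum≤ sum≤ ⟩
  2 ^ suc k * 2 ^ suc k              ≡⟨ ℕ.^-distribˡ-+-* 2 (suc k) (suc k) ⟨
  2 ^ (suc k + suc k)                ≡⟨ cong (λ l → 2 ^ (suc k + l)) (ℕ.+-identityʳ (suc k)) ⟨
  2 ^ (2 * suc k)                    ∎
  where
  open ℕ.≤-Reasoning
  sum≤ : suc (a + b) ≤ 2 ^ suc k
  sum≤ = ℕ.≤-trans (ℕ.+-mono-≤ a< (ℕ.<⇒≤ b<)) (ℕ.≤-reflexive (cong (2 ^ k +_) (sym (ℕ.+-identityʳ (2 ^ k)))))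

tagged : ℕ → ℕ → ℕ → ℕ
tagged t a b = pair t (pair a b)

tagged-injective : ∀ {t a b t′ a′ b′} → tagged t a b ≡ tagged t′ a′ b′ → t ≡ t′ × a ≡ a′ × b ≡ b′
tagged-injective {t} {a} {b} {t′} {a′} {b′} eq with t≡ , ab≡ ← pair-injective {t} {pair a b} {t′} {pair a′ b′}
    eq = t≡ , pair-injective {a} {b} {a′} {b′} ab≡

-- Each pairing turns k bits into 2 (k + 1), and two of them into 4 k + 6. The tag has two bits,
-- which fit into the intermediate 2 (k + 1) even for k = 0.
tagged<2^ : ∀ k {t a b} → t < 4 → a < 2 ^ k → b < 2 ^ k → tagged t a b < 2 ^ (4 * k + 6)
tagged<2^ k {t} {a} {b} t< a< b< = ℕ.<-≤-trans
  (pair<2^ (2 * suc k) {t} {pair a b} (ℕ.<-≤-trans t<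
      (ℕ.^-monoʳ-≤ 2 {2} {2 * suc k} (ℕ.*-monoʳ-≤ 2 {1} {suc k} (s≤s z≤n)))) (pair<2^ k {a} {b} a< b<))
  (ℕ.≤-reflexive (cong (2 ^_) exponent))
  where
  exponent : 2 * suc (2 * suc k) ≡ 4 * k + 6
  exponent = solve 1 (λ k → con 2 :* (con 1 :+ con 2 :* (con 1 :+ k)) := con 4 :* k :+ con 6) refl k
    where open +-*-Solver

n≤2^⌈log₂n⌉ : ∀ n → n ≤ 2 ^ ⌈log₂ n ⌉
n≤2^⌈log₂n⌉ = <-rec (λ n → n ≤ 2 ^ ⌈log₂ n ⌉) λ
  { zero          _   → z≤n
  ; (suc zero)    _   → s≤s z≤n
  ; n@(suc (suc m)) rec → begin
      n                                   ≡⟨ ℕ.⌊n/2⌋+⌈n/2⌉≡n n ⟨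
      ⌊ n /2⌋ + ⌈ n /2⌉                   ≤⟨ ℕ.+-monoˡ-≤ ⌈ n /2⌉ (ℕ.⌊n/2⌋≤⌈n/2⌉ n) ⟩
      ⌈ n /2⌉ + ⌈ n /2⌉                   ≡⟨ cong (⌈ n /2⌉ +_) (ℕ.+-identityʳ ⌈ n /2⌉) ⟨
      2 * ⌈ n /2⌉                         ≤⟨ ℕ.*-monoʳ-≤ 2 (rec (ℕ.⌈n/2⌉<n m)) ⟩
      2 ^ suc ⌈log₂ ⌈ n /2⌉ ⌉             ≡⟨ cong (λ l → 2 ^ suc l) (Log.⌈log₂⌈n/2⌉⌉≡⌈log₂n⌉∸1 n) ⟩
      2 ^ suc (⌈log₂ n ⌉ ∸ 1)             ≡⟨ cong (2 ^_)
          (ℕ.m+[n∸m]≡n (Log.⌈log₂⌉-mono-≤ {2} {n} (s≤s (s≤s z≤n)))) ⟩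
      2 ^ ⌈log₂ n ⌉                       ∎ }
  where open ℕ.≤-Reasoning

bitLength≤⇒<2^ : ∀ {i k} → bitLength i ≤ k → i < 2 ^ k
bitLength≤⇒<2^ {i} bits≤ = ℕ.≤-trans (n≤2^⌈log₂n⌉ (suc i)) (ℕ.^-monoʳ-≤ 2 bits≤)

<2^⇒bitLength≤ : ∀ {i k} → i < 2 ^ k → bitLength i ≤ k
<2^⇒bitLength≤ {k = k} i< = ℕ.≤-trans (Log.⌈log₂⌉-mono-≤ i<) (ℕ.≤-reflexive (Log.⌈log₂2^n⌉≡n k))

-- Networks on linear hypergraphs

≤max-tabulate : ∀ {k} (f : Fin k → ℕ) i → f i ≤ max 0 (tabulate f)
≤max-tabulate f i = v≤max⁺ 0 (tabulate f) (inj₂ (Any.tabulate⁺ i ℕ.≤-refl))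

max-tabulate : ∀ {k d} (f : Fin k → ℕ) → (∀ i → f i ≤ d) → ∀ i → f i ≡ d → max 0 (tabulate f) ≡ d
max-tabulate f f≤d i refl = ℕ.≤-antisym (max≤v⁺ z≤n (All.tabulate⁺ f≤d)) (≤max-tabulate f i)

degree-incident : ∀ {κ} {H : Hypergraph n} (net : Network κ H) v →
    Hypergraph.degree H v ≡ length (Network.incident net v)
degree-incident {H = H} net v = length-unique (Unique.filter⁺ (λ e → v Subset.∈? edge e) (Unique.allFin⁺ size))
    (incident-unique v)
  (mk⇔ (λ e∈ → from (incident-complete v _)
      (proj₂ (∈-filter⁻ (λ e → v Subset.∈? edge e) {xs = allFin size} e∈)))
       (λ e∈ → ∈-filter⁺ (λ e → v Subset.∈? edge e) (∈-allFin _) (to (incident-complete v _) e∈)))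
  where open Hypergraph H; open Network net

-- Two hyperedges share at most one vertex, so that listing the other endpoints
-- hyperedge by hyperedge never repeats a neighbor.
record LinearHypergraph (V E : Set) : Set where
  field
    members           : E → List V
    members-unique    : ∀ e → Unique (members e)
    members-nonempty  : ∀ e → ∃[ v ] v ∈ members e
    members-injective : ∀ {e f} → (∀ {v} → v ∈ members e ⇔ v ∈ members f) → e ≡ f
    inc               : V → List E
    inc-unique        : ∀ v → Unique (inc v)
    inc-complete      : ∀ {v e} → e ∈ inc v ⇔ v ∈ members e
    linear            : ∀ {v w e f} → v ≢ w → v ∈ members e → w ∈ members e →
                        v ∈ members f → w ∈ members f → e ≡ f

module Realization {V E : Set} (L : LinearHypergraph V E) {N s : ℕ} (V↔ : V ↔ Fin N) (E↔ : E ↔ Fin s) where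
  open LinearHypergraph L

  toV : V → Fin N
  toV = Inverse.to V↔

  fromV : Fin N → V
  fromV = Inverse.from V↔

  toE : E → Fin s
  toE = Inverse.to E↔

  fromE : Fin s → E
  fromE = Inverse.from E↔

  fromV-toV : ∀ v → fromV (toV v) ≡ v
  fromV-toV v = Inverse.strictlyInverseʳ V↔ v

  toV-fromV : ∀ x → toV (fromV x) ≡ x
  toV-fromV x = Inverse.strictlyInverseˡ V↔ x

  fromE-toE : ∀ e → fromE (toE e) ≡ e
  fromE-toE e = Inverse.strictlyInverseʳ E↔ e

  toE-fromE : ∀ f → toE (fromE f) ≡ f
  toE-fromE f = Inverse.strictlyInverseˡ E↔ f

  toV-injective : ∀ {v w} → toV v ≡ toV w → v ≡ w
  toV-injective {v} {w} eq = trans (sym (fromV-toV v)) (trans (cong fromV eq) (fromV-toV w))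

  toE-injective : ∀ {e f} → toE e ≡ toE f → e ≡ f
  toE-injective {e} {f} eq = trans (sym (fromE-toE e)) (trans (cong fromE eq) (fromE-toE f))

  fromE-injective : ∀ {e f} → fromE e ≡ fromE f → e ≡ f
  fromE-injective {e} {f} eq = trans (sym (toE-fromE e)) (trans (cong toE eq) (toE-fromE f))

  _≟ᵛ_ : (v w : V) → Dec (v ≡ w)
  v ≟ᵛ w = map′ toV-injective (cong toV) (toV v Fin.≟ toV w)

  oth : V → E → List V
  oth v e = filter (λ w → ¬? (w ≟ᵛ v)) (members e)

  ∈-oth : ∀ {v e w} → w ∈ oth v e ⇔ (w ∈ members e × w ≢ v)
  ∈-oth {v} {e} = mk⇔ (∈-filter⁻ (λ w → ¬? (w ≟ᵛ v)) {xs = members e})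
      (λ (w∈ , w≢v) → ∈-filter⁺ (λ w → ¬? (w ≟ᵛ v)) w∈ w≢v)

  ∈-map-toV : ∀ {x xs} → x ∈ map toV xs ⇔ fromV x ∈ xs
  ∈-map-toV {x} {xs} = mk⇔ ⇒ (λ x∈ → subst (_∈ map toV xs) (toV-fromV x) (∈-map⁺ toV x∈))
    where
    ⇒ : x ∈ map toV xs → fromV x ∈ xs
    ⇒ x∈ with v , v∈ , refl ← ∈-map⁻ toV x∈ = subst (_∈ xs) (sym (fromV-toV v)) v∈

  ∈-map-toE : ∀ {f es} → f ∈ map toE es ⇔ fromE f ∈ es
  ∈-map-toE {f} {es} = mk⇔ ⇒ (λ f∈ → subst (_∈ map toE es) (toE-fromE f) (∈-map⁺ toE f∈))
    where
    ⇒ : f ∈ map toE es → fromE f ∈ es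
    ⇒ f∈ with e , e∈ , refl ← ∈-map⁻ toE f∈ = subst (_∈ es) (sym (fromE-toE e)) e∈

  edgeSet : Fin s → Subset N
  edgeSet f = fromList (map toV (members (fromE f)))

  ∈-edgeSet : ∀ {x f} → x ∈ˢ edgeSet f ⇔ fromV x ∈ members (fromE f)
  ∈-edgeSet = mk⇔ (to ∈-map-toV ∘ to ∈-fromList) (from ∈-fromList ∘ from ∈-map-toV)

  toV∈edgeSet : ∀ {v e} → toV v ∈ˢ edgeSet (toE e) ⇔ v ∈ members e
  toV∈edgeSet {v} {e} = mk⇔ (λ v∈ → subst₂ _∈_ (fromV-toV v) (cong members (fromE-toE e)) (to ∈-edgeSet v∈))
    (λ v∈ → from ∈-edgeSet (subst₂ _∈_ (sym (fromV-toV v)) (cong members (sym (fromE-toE e))) v∈))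

  hypergraph : Hypergraph N
  hypergraph = record
    { size     = s
    ; edge     = edgeSet
    ; nonempty = λ f → let v , v∈ = members-nonempty (fromE f) in toV v , from ∈-fromList (∈-map⁺ toV v∈)
    ; distinct = λ {e} {f} eq → fromE-injective (members-injective λ {v} →
        mk⇔ (transfer eq) (transfer (sym eq)))
    }
    where
    transfer : ∀ {e f v} → edgeSet e ≡ edgeSet f → v ∈ members (fromE e) → v ∈ members (fromE f)
    transfer {e} {f} {v} eq v∈ = subst (_∈ members (fromE f)) (fromV-toV v)
      (to ∈-edgeSet (subst (toV v ∈ˢ_) eq (from ∈-fromList (∈-map⁺ toV v∈))))

  open Hypergraph hypergraph using (ShareVertex; rank; degree; maxDegree)

  ShareVertex⇔ : ∀ {e f} → ShareVertex (toE e) (toE f) ⇔ (∃[ v ] (v ∈ members e × v ∈ members f))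
  ShareVertex⇔ {e} {f} = mk⇔ ⇒ λ (v , v∈e , v∈f) →
      toV v , Subset.x∈p∩q⁺ (from toV∈edgeSet v∈e , from toV∈edgeSet v∈f)
    where
    ⇒ : ShareVertex (toE e) (toE f) → _
    ⇒ (x , x∈) with x∈e , x∈f ← Subset.x∈p∩q⁻ (edgeSet (toE e)) (edgeSet (toE f)) x∈ =
      fromV x , subst (λ g → fromV x ∈ members g) (fromE-toE e) (to ∈-edgeSet x∈e)
              , subst (λ g → fromV x ∈ members g) (fromE-toE f) (to ∈-edgeSet x∈f)

  ∣edgeSet∣ : ∀ f → ∣ edgeSet f ∣ ≡ length (members (fromE f))
  ∣edgeSet∣ f = trans (∣∣-unique (Unique.map⁺ toV-injective (members-unique (fromE f))) ∈-fromList)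
      (length-map toV (members (fromE f)))

  rank-realized : ∀ {r} → (∀ e → length (members e) ≤ r) → ∀ e → length (members e) ≡ r → rank ≡ r
  rank-realized ≤r e ≡r = max-tabulate _ (λ f → ℕ.≤-trans (ℕ.≤-reflexive (∣edgeSet∣ f)) (≤r (fromE f))) (toE e)
    (trans (∣edgeSet∣ (toE e)) (trans (cong (length ∘ members) (fromE-toE e)) ≡r))

  module Labelled (κ : ℕ) (ident : V → ℕ) (ident-injective : ∀ {v w} → ident v ≡ ident w → v ≡ w)
                  (ident-length : ∀ v → bitLength (ident v) ≤ κ * ⌈log₂ N ⌉) where

    -- `Network` leaves the enumeration of neighbors free. In this one the other endpoints of a
    -- hyperedge form a contiguous block.
    adjacentVertices : V → List V
    adjacentVertices v = concatMap (oth v) (inc v)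

    adjacentVertices-unique : ∀ v → Unique (adjacentVertices v)
    adjacentVertices-unique v = unique-concatMap (oth v) (inc-unique v)
      (λ {e} _ → Unique.filter⁺ (λ w → ¬? (w ≟ᵛ v)) (members-unique e))
      λ e∈ f∈ w∈e w∈f → let w∈e′ , w≢v = to ∈-oth w∈e in
        linear (≢-sym w≢v) (to inc-complete e∈) w∈e′ (to inc-complete f∈) (proj₁ (to ∈-oth w∈f))

    ∈-adjacentVertices : ∀ {v w} → w ∈ adjacentVertices v ⇔ (v ≢ w × ∃[ e ] (v ∈ members e × w ∈ members e))
    ∈-adjacentVertices {v} {w} = mk⇔ ⇒ λ (v≢w , e , v∈ , w∈) →
        ∈-concatMap⁺ (oth v) (Any.map (λ { refl → from ∈-oth (w∈ , ≢-sym v≢w) }) (from inc-complete v∈))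
      where
      ⇒ : w ∈ adjacentVertices v → _
      ⇒ w∈ with e , e∈ , w∈e ← find (∈-concatMap⁻ (oth v) {inc v} w∈) =
        ≢-sym (proj₂ (to ∈-oth w∈e)) , e , to inc-complete e∈ , proj₁ (to ∈-oth w∈e)

    network : Network κ hypergraph
    network = record
      { identifier         = ident ∘ fromV
      ; identifier-unique  = λ {x} {y} eq →
          trans (sym (toV-fromV x)) (trans (cong toV (ident-injective eq)) (toV-fromV y))
      ; identifier-length  = λ x → ident-length (fromV x)
      ; incident           = λ x → map toE (inc (fromV x))
      ; incident-unique    = λ x → Unique.map⁺ toE-injective (inc-unique (fromV x))
      ; incident-complete  = λ x f → mk⇔ (from ∈-edgeSet ∘ to inc-complete ∘ to ∈-map-toE)
                                         (from ∈-map-toE ∘ from inc-complete ∘ to ∈-edgeSet)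
      ; neighbors          = λ x → map toV (adjacentVertices (fromV x))
      ; neighbors-unique   = λ x → Unique.map⁺ toV-injective (adjacentVertices-unique (fromV x))
      ; neighbors-complete = λ x y → mk⇔ (⇒ ∘ to ∈-adjacentVertices ∘ to ∈-map-toV)
          (from ∈-map-toV ∘ from ∈-adjacentVertices ∘ ⇐)
      }
      where
      ⇒ : ∀ {x y} → fromV x ≢ fromV y × ∃[ e ] (fromV x ∈ members e × fromV y ∈ members e) →
          Hypergraph.Neighbors hypergraph x y
      ⇒ {x} {y} (x≢y , e , x∈ , y∈) = x≢y ∘ cong fromV , toE e ,
        subst (_∈ˢ edgeSet (toE e)) (toV-fromV x) (from toV∈edgeSet x∈) ,
        subst (_∈ˢ edgeSet (toE e)) (toV-fromV y) (from toV∈edgeSet y∈)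
      ⇐ : ∀ {x y} → Hypergraph.Neighbors hypergraph x y →
          fromV x ≢ fromV y × ∃[ e ] (fromV x ∈ members e × fromV y ∈ members e)
      ⇐ {x} {y} (x≢y , f , x∈ , y∈) =
        (λ eq → x≢y (trans (sym (toV-fromV x)) (trans (cong toV eq) (toV-fromV y)))) , fromE f , to ∈-edgeSet x∈
            , to ∈-edgeSet y∈

    open Network network using (incident; neighbors; others)

    incident-toV : ∀ v → incident (toV v) ≡ map toE (inc v)
    incident-toV v = cong (map toE ∘ inc) (fromV-toV v)

    degree-toV : ∀ v → degree (toV v) ≡ length (inc v)
    degree-toV v = trans (degree-incident network (toV v))
        (trans (cong length (incident-toV v)) (length-map toE (inc v)))

    maxDegree-realized : ∀ {d} → (∀ v → length (inc v) ≤ d) → ∀ v → length (inc v) ≡ d → maxDegree ≡ d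
    maxDegree-realized ≤d v ≡d = max-tabulate degree
      (λ x → ℕ.≤-trans (ℕ.≤-reflexive (trans (degree-incident network x) (length-map toE (inc (fromV x)))))
          (≤d (fromV x)))
      (toV v) (trans (degree-toV v) ≡d)

    -- Filtering all neighbors by membership in `e` keeps exactly the block of `e`: by linearity, an
    -- endpoint of another hyperedge at `v` does not lie in `e`.
    others-toV : ∀ {v e} → e ∈ inc v → others (toV v) (toE e) ≡ map toV (oth v e)
    others-toV {v} {e} e∈ = trans (cong (λ u →
        filter (λ w → w Subset.∈? edgeSet (toE e)) (map toV (adjacentVertices u))) (fromV-toV v))
      (trans (filter-map (λ w → w Subset.∈? edgeSet (toE e)) toV (adjacentVertices v))
        (cong (map toV) (filter-concatMap (λ w → toV w Subset.∈? edgeSet (toE e)) (oth v) (inc-unique v) e∈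
          (λ w∈ → from toV∈edgeSet (proj₁ (to ∈-oth w∈)))
          λ f∈ f≢e w∈f w∈e → let w∈f′ , w≢v = to ∈-oth w∈f in
            f≢e (linear (≢-sym w≢v) (to inc-complete f∈) w∈f′ (to inc-complete e∈) (to toV∈edgeSet w∈e)))))

    module Run {O : Set} (𝒜 : Algorithm ⊤ O) where
      open Algorithm 𝒜
      open Execution 𝒜 network (λ _ → tt)

      -- No trace of the neighbors or of the size of the hypergraph remains, so a node of G can
      -- produce the initial view of each vertex that it runs.
      view-toV : ∀ v → view (toV v) ≡ localView (ident v)
          (map (tt ,_) (segments 0 (map (length ∘ oth v) (inc v))))
      view-toV v = cong₂ localView (cong ident (fromV-toV v)) (begin
        map (λ f → tt , map (λ w → position w (neighbors (toV v))) (others (toV v) f)) (incident (toV v))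
          ≡⟨ cong (map _) (incident-toV v) ⟩
        map (λ f → tt , map (λ w → position w (neighbors (toV v))) (others (toV v) f)) (map toE (inc v))
          ≡⟨ map-∘ (inc v) ⟨
        map (λ e → tt , map (λ w → position w (neighbors (toV v))) (others (toV v) (toE e))) (inc v)
          ≡⟨ map-cong-local (All.tabulate λ {e} e∈ → cong (tt ,_) (trans
               (cong (map _) (others-toV e∈)) (map-cong (λ w → cong (position w) neighbors≡)
                   (map toV (oth v e))))) ⟩
        map (λ e → tt , map (λ w → position w (concat blocks)) (map toV (oth v e))) (inc v)
          ≡⟨ trans (map-∘ (inc v)) (map-∘ blocks) ⟩
        map (tt ,_) (map (map (λ w → position w (concat blocks))) blocks)
          ≡⟨ cong (map (tt ,_)) (positions-segments [] blocks
              (subst Unique neighbors≡ (Network.neighbors-unique network (toV v)))) ⟩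
        map (tt ,_) (segments 0 (map length blocks))
          ≡⟨ cong (map (tt ,_) ∘ segments 0) (trans (sym (map-∘ (inc v)))
              (map-cong (λ e → length-map toV (oth v e)) (inc v))) ⟩
        map (tt ,_) (segments 0 (map (length ∘ oth v) (inc v))) ∎)
        where
        open ≡-Reasoning
        blocks : List (List (Fin N))
        blocks = map (map toV ∘ oth v) (inc v)
        neighbors≡ : neighbors (toV v) ≡ concat blocks
        neighbors≡ = trans (cong (map toV ∘ adjacentVertices) (fromV-toV v))
          (trans (sym (concat-map (map (oth v) (inc v)))) (cong concat (sym (map-∘ (inc v)))))

      stateOf : ℕ → V → State
      stateOf t v = state t (toV v)

      portOf : E → V → ℕ
      portOf e w = position (toE e) (map toE (inc w))

      stateOf-suc : ∀ t v → stateOf (suc t) v ≡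
        receive (stateOf t v) (map (λ e → map (λ w → send (stateOf t w) (portOf e w)) (oth v e)) (inc v))
      stateOf-suc t v = cong (receive (stateOf t v)) (begin
        map (λ f → map (λ y → send (state t y) (position f (incident y))) (others (toV v) f)) (incident (toV v))
          ≡⟨ cong (map _) (incident-toV v) ⟩
        map (λ f → map (λ y → send (state t y) (position f (incident y))) (others (toV v) f)) (map toE (inc v))
          ≡⟨ map-∘ (inc v) ⟨
        map (λ e → map (λ y → send (state t y) (position (toE e) (incident y))) (others (toV v) (toE e)))
            (inc v)
          ≡⟨ map-cong-local (All.tabulate λ {e} e∈ →
              trans (cong (map _) (others-toV e∈)) (trans (sym (map-∘ (oth v e)))
               (map-cong (λ w → cong (send (stateOf t w) ∘ position (toE e)) (incident-toV w)) (oth v e)))) ⟩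
        map (λ e → map (λ w → send (stateOf t w) (portOf e w)) (oth v e)) (inc v) ∎)
        where open ≡-Reasoning

-- Graphs

length-concatMap-≤ : {f : A → List B} {b : ℕ} {xs : List A} → (∀ {x} → x ∈ xs → length (f x) ≤ b) →
                     length (concatMap f xs) ≤ length xs * b
length-concatMap-≤ {xs = []}     ≤b = z≤n
length-concatMap-≤ {f = f} {xs = x ∷ xs} ≤b = ℕ.≤-trans (ℕ.≤-reflexive (length-++ (f x)))
  (ℕ.+-mono-≤ (≤b (here refl)) (length-concatMap-≤ (≤b ∘ there)))

module Graph {n : ℕ} (G : Hypergraph n) (isGraph : IsGraph G) {κ : ℕ} (net : Network κ G) where
  open Hypergraph G
  open Network net

  -- Ordered by identifier because this is an order that both endpoints can determine after one
  -- exchange. The identifier of the vertex `e` and the order of its messages rely on it.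
  record Endpoints (e : Fin size) : Set where
    field
      lo hi  : Fin n
      lo<hi  : identifier lo < identifier hi
      ∈-edge : ∀ {x} → x ∈ˢ edge e ⇔ (x ≡ lo ⊎ x ≡ hi)

  endpoints : ∀ e → Endpoints e
  endpoints e = order (elements (edge e)) (trans (length-elements (edge e)) (isGraph e))
      (elements-unique (edge e))
                      (mk⇔ (from ∈-elements) (to ∈-elements))
    where
    order : ∀ xs → length xs ≡ 2 → Unique xs → (∀ {x} → x ∈ˢ edge e ⇔ x ∈ xs) → Endpoints e
    order (a ∷ b ∷ []) _ ((a≢b ∷ []) ∷ _) ∈⇔ with ℕ.<-cmp (identifier a) (identifier b)
    ... | tri< a<b _ _ = record { lo = a ; hi = b ; lo<hi = a<b ; ∈-edge = mk⇔
          (λ x∈ → case to ∈⇔ x∈ of λ { (here eq) → inj₁ eq ; (there (here eq)) → inj₂ eq })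
          λ { (inj₁ eq) → from ∈⇔ (here eq) ; (inj₂ eq) → from ∈⇔ (there (here eq)) } }
    ... | tri≈ _ a≡b _ = ⊥-elim (a≢b (identifier-unique a≡b))
    ... | tri> _ _ b<a = record { lo = b ; hi = a ; lo<hi = b<a ; ∈-edge = mk⇔
          (λ x∈ → case to ∈⇔ x∈ of λ { (here eq) → inj₂ eq ; (there (here eq)) → inj₁ eq })
          λ { (inj₂ eq) → from ∈⇔ (here eq) ; (inj₁ eq) → from ∈⇔ (there (here eq)) } }

  open module Ends (e : Fin size) = Endpoints (endpoints e) public using (lo; hi; lo<hi)

  ∈-edge : ∀ {e x} → x ∈ˢ edge e ⇔ (x ≡ lo e ⊎ x ≡ hi e)
  ∈-edge {e} = Endpoints.∈-edge (endpoints e)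

  lo∈ : ∀ e → lo e ∈ˢ edge e
  lo∈ e = from ∈-edge (inj₁ refl)

  hi∈ : ∀ e → hi e ∈ˢ edge e
  hi∈ e = from ∈-edge (inj₂ refl)

  lo≢hi : ∀ e → lo e ≢ hi e
  lo≢hi e eq = ℕ.<-irrefl (cong identifier eq) (lo<hi e)

  other : Fin n → Fin size → Fin n
  other u e = if does (u Fin.≟ lo e) then hi e else lo e

  other-lo : ∀ e → other (lo e) e ≡ hi e
  other-lo e with lo e Fin.≟ lo e
  ... | yes _ = refl
  ... | no ≢  = ⊥-elim (≢ refl)

  other-hi : ∀ e → other (hi e) e ≡ lo e
  other-hi e with hi e Fin.≟ lo e
  ... | yes eq = ⊥-elim (lo≢hi e (sym eq))
  ... | no _   = refl

  other-cases : ∀ {u e} → u ∈ˢ edge e → (u ≡ lo e × other u e ≡ hi e) ⊎ (u ≡ hi e × other u e ≡ lo e)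
  other-cases {e = e} u∈ with to ∈-edge u∈
  ... | inj₁ refl = inj₁ (refl , other-lo e)
  ... | inj₂ refl = inj₂ (refl , other-hi e)

  other-∈ : ∀ {u e} → u ∈ˢ edge e → other u e ∈ˢ edge e
  other-∈ {e = e} u∈ with other-cases u∈
  ... | inj₁ (_ , eq) = from ∈-edge (inj₂ eq)
  ... | inj₂ (_ , eq) = from ∈-edge (inj₁ eq)

  other≢ : ∀ {u e} → u ∈ˢ edge e → other u e ≢ u
  other≢ {e = e} u∈ eq with other-cases u∈
  ... | inj₁ (u≡ , o≡) = lo≢hi e (trans (sym u≡) (trans (sym eq) o≡))
  ... | inj₂ (u≡ , o≡) = lo≢hi e (trans (sym o≡) (trans eq u≡))

  other-only : ∀ {u e x} → u ∈ˢ edge e → x ∈ˢ edge e → x ≢ u → x ≡ other u e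
  other-only {e = e} u∈ x∈ x≢u with other-cases u∈ | to ∈-edge x∈
  ... | inj₁ (u≡ , o≡) | inj₁ x≡ = ⊥-elim (x≢u (trans x≡ (sym u≡)))
  ... | inj₁ (u≡ , o≡) | inj₂ x≡ = trans x≡ (sym o≡)
  ... | inj₂ (u≡ , o≡) | inj₁ x≡ = trans x≡ (sym o≡)
  ... | inj₂ (u≡ , o≡) | inj₂ x≡ = ⊥-elim (x≢u (trans x≡ (sym u≡)))

  others≡ : ∀ {u e} → u ∈ˢ edge e → others u e ≡ other u e ∷ []
  others≡ {u} {e} u∈ = unique-singleton (Unique.filter⁺ (Subset._∈? edge e) (neighbors-unique u)) (mk⇔
    (λ x∈ → let x∈nb , x∈e = ∈-filter⁻ (Subset._∈? edge e) {xs = neighbors u} x∈ in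
      other-only u∈ x∈e (≢-sym (proj₁ (to (neighbors-complete u _) x∈nb))))
    λ { refl → ∈-filter⁺ (Subset._∈? edge e)
        (from (neighbors-complete u _) (≢-sym (other≢ u∈) , e , u∈ , other-∈ u∈)) (other-∈ u∈) })

  simple : ∀ {v w e f} → v ≢ w → v ∈ˢ edge e → w ∈ˢ edge e → v ∈ˢ edge f → w ∈ˢ edge f → e ≡ f
  simple {v} {w} v≢w v∈e w∈e v∈f w∈f = distinct (Subset.⊆-antisym (⊆ v∈e w∈e v∈f w∈f) (⊆ v∈f w∈f v∈e w∈e))
    where
    ⊆ : ∀ {e f} → v ∈ˢ edge e → w ∈ˢ edge e → v ∈ˢ edge f → w ∈ˢ edge f → ∀ {x} → x ∈ˢ edge e → x ∈ˢ edge f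
    ⊆ {f = f} v∈e w∈e v∈f w∈f {x} x∈ with x Fin.≟ v
    ... | yes refl = v∈f
    ... | no x≢v   = subst (_∈ˢ edge f) (trans (other-only v∈e w∈e (≢-sym v≢w)) (sym (other-only v∈e x∈ x≢v)))
        w∈f

  length-incident≤ : ∀ v → length (incident v) ≤ maxDegree
  length-incident≤ v = ℕ.≤-trans (ℕ.≤-reflexive (sym (degree-incident net v))) (≤max-tabulate degree v)

  -- Every edge occurs in the incidence list of its lower endpoint. The factor 2 given away against
  -- counting both endpoints still fits into the 2nΔ² vertices.
  size≤ : size ≤ n * maxDegree
  size≤ = begin
    size                                    ≡⟨ length-tabulate {n = size} id ⟨
    length (allFin size)                    ≤⟨ length-mono-⊆ (Unique.allFin⁺ size)
        (λ {e} _ → ∈-concatMap⁺ incident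
                                                 (Any.map (λ { refl → from (incident-complete _ e) (lo∈ e) })
                                                     (∈-allFin (lo e)))) ⟩
    length (concatMap incident (allFin n))  ≤⟨ length-concatMap-≤ {f = incident} {xs = allFin n}
        (λ {v} _ → length-incident≤ v) ⟩
    length (allFin n) * maxDegree           ≡⟨ cong (_* maxDegree) (length-tabulate {n = n} id) ⟩
    n * maxDegree                           ∎
    where open ℕ.≤-Reasoning

  2≤n : Fin size → 2 ≤ n
  2≤n e = subst (2 ≤_) (length-tabulate {n = n} id)
      (length-mono-⊆ {xs = lo e ∷ hi e ∷ []} ((lo≢hi e ∷ []) ∷ [] ∷ []) λ _ → ∈-allFin _)

  1≤maxDegree : Fin size → 1 ≤ maxDegree
  1≤maxDegree e = ℕ.≤-trans (∈-length (from (incident-complete (lo e) e) (lo∈ e))) (length-incident≤ (lo e))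

  -- The edge `e` and its adjacent edges occur among the at most Δ edges at `lo e` and the at most Δ
  -- - 1 edges at `hi e` other than `e`. Counting `e` along with its adjacent edges makes this a
  -- bound on the list length.
  edgeDegree< : ∀ e → suc (edgeDegree e) ≤ 2 * maxDegree ∸ 1
  edgeDegree< e = begin
    suc (length adj)                               ≤⟨ length-mono-⊆
        (All.tabulate (λ f∈ → proj₁ (adjacent f∈)) ∷ Unique.filter⁺ (adjacent? e) (Unique.allFin⁺ size)) ⊆ends ⟩
    length (incident (lo e) ++ rest)               ≡⟨ length-++ (incident (lo e)) ⟩
    length (incident (lo e)) + length rest         ≤⟨ ℕ.+-mono-≤ (length-incident≤ (lo e))
        (ℕ.∸-monoˡ-≤ 1 rest<) ⟩
    maxDegree + (maxDegree ∸ 1)                    ≡⟨ ℕ.+-∸-assoc maxDegree (1≤maxDegree e) ⟨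
    maxDegree + maxDegree ∸ 1                      ≡⟨ cong (λ d → maxDegree + d ∸ 1) (ℕ.+-identityʳ maxDegree) ⟨
    2 * maxDegree ∸ 1                              ∎
    where
    open ℕ.≤-Reasoning
    adj = filter (adjacent? e) (allFin size)
    rest = filter (λ f → ¬? (e Fin.≟ f)) (incident (hi e))
    adjacent : ∀ {f} → f ∈ adj → Adjacent e f
    adjacent f∈ = proj₂ (∈-filter⁻ (adjacent? e) {xs = allFin size} f∈)
    rest< : suc (length rest) ≤ maxDegree
    rest< = ℕ.≤-trans (filter-notAll (λ f → ¬? (e Fin.≟ f)) (incident (hi e))
      (Any.map (λ e≡f ≢ → ≢ e≡f) (from (incident-complete (hi e) e) (hi∈ e)))) (length-incident≤ (hi e))
    ⊆ends : ∀ {f} → f ∈ e ∷ adj → f ∈ incident (lo e) ++ rest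
    ⊆ends (here refl) = ∈-++⁺ˡ (from (incident-complete (lo e) e) (lo∈ e))
    ⊆ends {f} (there f∈) with e≢f , x , x∈ ← adjacent f∈ with x∈e , x∈f ← Subset.x∈p∩q⁻ (edge e)
        (edge f) x∈ with to ∈-edge x∈e
    ... | inj₁ refl = ∈-++⁺ˡ (from (incident-complete (lo e) f) x∈f)
    ... | inj₂ refl = ∈-++⁺ʳ (incident (lo e))
        (∈-filter⁺ (λ g → ¬? (e Fin.≟ g)) (from (incident-complete (hi e) f) x∈f) e≢f)

-- The hypergraph of choices

palette : List (List ℕ) → List ℕ
palette ls = deduplicate ℕ._≟_ (concat ls)

palette-unique : ∀ ls → Unique (palette ls)
palette-unique ls = deduplicate-! ℕ._≟_ (concat ls)

∈-palette : ∀ {c l ls} → c ∈ l → l ∈ ls → c ∈ palette ls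
∈-palette c∈ l∈ = ∈-deduplicate⁺ ℕ._≟_ (∈-concat⁺′ c∈ l∈)

-- A hypergraph whose maximum degree is to be exactly d gets, if necessary, a
-- star of d hyperedges on spare vertices: star q is the vertex set of the q-th one.
star : ∀ {p} → Fin p → List (Fin p)
star zero    = zero ∷ []
star (suc q) = zero ∷ suc q ∷ []

-- The singleton `star zero` counts as a ray of the centre, which therefore reaches degree p in a
-- star on only p vertices.
rays : ∀ {p} → Fin p → List (Fin p)
rays zero    = allFin _
rays (suc q) = suc q ∷ []

star-unique : ∀ {p} (q : Fin p) → Unique (star q)
star-unique zero    = [] ∷ []
star-unique (suc q) = ((λ ()) ∷ []) ∷ [] ∷ []

rays-unique : ∀ {p} (q : Fin p) → Unique (rays q)
rays-unique zero    = Unique.allFin⁺ _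
rays-unique (suc q) = [] ∷ []

∈-star : ∀ {p} (q : Fin p) → q ∈ star q
∈-star zero    = here refl
∈-star (suc q) = there (here refl)

∈-rays : ∀ {p} {q r : Fin p} → r ∈ rays q ⇔ q ∈ star r
∈-rays = mk⇔ ⇒ ⇐
  where
  ⇒ : ∀ {p} {q r : Fin p} → r ∈ rays q → q ∈ star r
  ⇒ {q = zero}  {zero}  _           = here refl
  ⇒ {q = zero}  {suc r} _           = here refl
  ⇒ {q = suc q} (here refl)         = there (here refl)
  ⇐ : ∀ {p} {q r : Fin p} → q ∈ star r → r ∈ rays q
  ⇐ {r = zero}  (here refl)         = ∈-allFin _
  ⇐ {r = suc r} (here refl)         = ∈-allFin _
  ⇐ {r = suc r} (there (here refl)) = here refl

suc∈star : ∀ {p} {q : Fin p} {r : Fin (suc p)} → suc q ∈ star r → suc q ≡ r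
suc∈star {r = zero}  (here ())
suc∈star {r = suc r} (there (here eq)) = eq

star-linear : ∀ {p} {q q′ r r′ : Fin p} → q ≢ q′ → q ∈ star r → q′ ∈ star r → q ∈ star r′ → q′ ∈ star r′ →
    r ≡ r′
star-linear {r = zero} q≢ (here refl) (here refl) _ _ = ⊥-elim (q≢ refl)
star-linear {r = suc r} q≢ (here refl) (here refl) _ _ = ⊥-elim (q≢ refl)
star-linear {r = suc r} q≢ (there (here refl)) (there (here refl)) _ _ = ⊥-elim (q≢ refl)
star-linear {r = suc r} q≢ (here refl) (there (here refl)) _ q′∈ = suc∈star q′∈
star-linear {r = suc r} q≢ (there (here refl)) (here refl) q∈ _ = suc∈star q∈

star-injective : ∀ {p} {r r′ : Fin p} → (∀ {q} → q ∈ star r ⇔ q ∈ star r′) → r ≡ r′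
star-injective {r = zero}  {zero}   eq = refl
star-injective {r = zero}  {suc r′} eq = sym (suc∈star (from eq (∈-star (suc r′))))
star-injective {r = suc r} {r′}     eq = suc∈star (to eq (∈-star (suc r)))

≤total : ∀ {m} (f : Fin m → ℕ) i → f i ≤ total f
≤total f zero    = ℕ.m≤m+n (f zero) _
≤total f (suc i) = ℕ.≤-trans (≤total (f ∘ suc) i) (ℕ.m≤n+m _ (f zero))

module Line {n : ℕ} (G : Hypergraph n) (isGraph : IsGraph G) {κ : ℕ} (net : Network κ G) (L : ListAssignment G)
            (p r : ℕ) where
  open Hypergraph G
  open Network net
  open ListAssignment L
  open Graph G isGraph net

  Slot : Fin size → Set
  Slot e = Fin (length (colors e))

  colorAt : ∀ e → Slot e → ℕ
  colorAt e = lookup (colors e)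

  colorAt-injective : ∀ {e} {k l : Slot e} → colorAt e k ≡ colorAt e l → k ≡ l
  colorAt-injective {e} = lookup-injective (colors-distinct e)

  lists : Fin n → List (List ℕ)
  lists u = map colors (incident u)

  hues : Fin n → List ℕ
  hues u = palette (lists u)

  hue : ∀ u → Fin (length (hues u)) → ℕ
  hue u = lookup (hues u)

  hue-injective : ∀ {u i j} → hue u i ≡ hue u j → i ≡ j
  hue-injective {u} = lookup-injective (palette-unique (lists u))

  colorAt∈hues : ∀ {u e} → u ∈ˢ edge e → ∀ k → colorAt e k ∈ hues u
  colorAt∈hues {u} {e} u∈ k = ∈-palette (∈-lookup k) (∈-map⁺ colors (from (incident-complete u e) u∈))

  hueAt : ∀ {u e} → u ∈ˢ edge e → (k : Slot e) → Fin (length (hues u))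
  hueAt u∈ k = Any.index (colorAt∈hues u∈ k)

  hue-hueAt : ∀ {u e} (u∈ : u ∈ˢ edge e) k → hue u (hueAt u∈ k) ≡ colorAt e k
  hue-hueAt u∈ k = sym (Any.lookup-index (colorAt∈hues u∈ k))

  Choice : Set
  Choice = Σ (Fin size) Slot

  -- The idle vertices pad the number of vertices, which has to be exactly 2 n Δ².
  V : Set
  V = Fin size ⊎ Σ (Fin n) (λ u → Fin (length (hues u))) ⊎ Fin p ⊎ Fin r

  pattern edgeᵛ e    = inj₁ e
  pattern colorᵛ u i = inj₂ (inj₁ (u , i))
  pattern padᵛ q     = inj₂ (inj₂ (inj₁ q))
  pattern idleᵛ q    = inj₂ (inj₂ (inj₂ q))

  E : Set
  E = Choice ⊎ Fin p

  members : E → List V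
  members (inj₁ (e , k)) = edgeᵛ e ∷ colorᵛ (lo e) (hueAt (lo∈ e) k) ∷ colorᵛ (hi e) (hueAt (hi∈ e) k) ∷ []
  members (inj₂ q)       = map padᵛ (star q)

  -- Membership expressed by colors instead of palette indices, so that arguments about incidence
  -- compare colors and avoid `hueAt`, which depends on a proof of incidence.
  Incident : V → E → Set
  Incident (edgeᵛ e)    (inj₁ (f , _)) = e ≡ f
  Incident (colorᵛ u i) (inj₁ (f , k)) = u ∈ˢ edge f × hue u i ≡ colorAt f k
  Incident (inj₂ (inj₂ _)) (inj₁ _)    = ⊥
  Incident (padᵛ q)     (inj₂ s)       = q ∈ star s
  Incident _            (inj₂ _)       = ⊥

  ∈-members : ∀ {v e} → v ∈ members e ⇔ Incident v e
  ∈-members = mk⇔ (⇒ _) (⇐ _ _)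
    where
    ⇒ : ∀ {v} e → v ∈ members e → Incident v e
    ⇒ (inj₁ (e , k)) (here refl)                 = refl
    ⇒ (inj₁ (e , k)) (there (here refl))         = lo∈ e , hue-hueAt (lo∈ e) k
    ⇒ (inj₁ (e , k)) (there (there (here refl))) = hi∈ e , hue-hueAt (hi∈ e) k
    ⇒ (inj₂ q) v∈ with s , s∈ , refl ← ∈-map⁻ padᵛ v∈ = s∈
    ⇐ : ∀ v e → Incident v e → v ∈ members e
    ⇐ (edgeᵛ e) (inj₁ (f , k)) refl = here refl
    ⇐ (colorᵛ u i) (inj₁ (f , k)) (u∈ , eq) with to ∈-edge u∈
    ... | inj₁ refl = there (here (cong (colorᵛ u) (hue-injective (trans eq (sym (hue-hueAt (lo∈ f) k))))))
    ... | inj₂ refl = there (there (here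
        (cong (colorᵛ u) (hue-injective (trans eq (sym (hue-hueAt (hi∈ f) k)))))))
    ⇐ (padᵛ q) (inj₂ s) q∈ = ∈-map⁺ padᵛ q∈

  -- Follows the order of the given edges, so that the ports of (u , c) are those of u with the
  -- edges that lack c left out.
  choices : ℕ → List (Fin size) → List Choice
  choices c [] = []
  choices c (e ∷ es) with c ∈? colors e
  ... | yes c∈ = (e , Any.index c∈) ∷ choices c es
  ... | no _   = choices c es

  ∈-choices : ∀ {c es e k} → (e , k) ∈ choices c es ⇔ (e ∈ es × c ≡ colorAt e k)
  ∈-choices = mk⇔ (⇒ _ _) (λ (e∈ , eq) → ⇐ _ _ e∈ eq)
    where
    ⇒ : ∀ c es {e k} → (e , k) ∈ choices c es → e ∈ es × c ≡ colorAt e k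
    ⇒ c (f ∷ es) ek∈ with c ∈? colors f
    ⇒ c (f ∷ es) (here refl) | yes c∈ = here refl , Any.lookup-index c∈
    ⇒ c (f ∷ es) (there ek∈) | yes c∈ = let e∈ , eq = ⇒ c es ek∈ in there e∈ , eq
    ⇒ c (f ∷ es) ek∈ | no _ = let e∈ , eq = ⇒ c es ek∈ in there e∈ , eq
    ⇐ : ∀ c es {e k} → e ∈ es → c ≡ colorAt e k → (e , k) ∈ choices c es
    ⇐ c (f ∷ es) e∈ eq with c ∈? colors f
    ⇐ c (f ∷ es) (here refl) eq | yes c∈ =
        here (cong (f ,_) (colorAt-injective (trans (sym eq) (Any.lookup-index c∈))))
    ⇐ c (f ∷ es) (there e∈)  eq | yes c∈ = there (⇐ c es e∈ eq)
    ⇐ c (f ∷ es) (here refl) eq | no c∉  = ⊥-elim (c∉ (subst (_∈ colors f) (sym eq) (∈-lookup _)))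
    ⇐ c (f ∷ es) (there e∈)  eq | no _   = ⇐ c es e∈ eq

  choices-unique : ∀ c {es} → Unique es → Unique (choices c es)
  choices-unique c [] = []
  choices-unique c {e ∷ es} (e∉ ∷ u) with c ∈? colors e
  ... | yes c∈ = All.tabulate (λ ch∈ eq → All.lookup e∉ (proj₁ (to ∈-choices ch∈)) (cong proj₁ eq)) ∷
      choices-unique c u
  ... | no _   = choices-unique c u

  length-choices≤ : ∀ c es → length (choices c es) ≤ length es
  length-choices≤ c [] = z≤n
  length-choices≤ c (e ∷ es) with c ∈? colors e
  ... | yes _ = s≤s (length-choices≤ c es)
  ... | no _  = ℕ.m≤n⇒m≤1+n (length-choices≤ c es)

  inc : V → List E
  inc (edgeᵛ e)    = map (λ k → inj₁ (e , k)) (allFin (length (colors e)))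
  inc (colorᵛ u i) = map inj₁ (choices (hue u i) (incident u))
  inc (padᵛ q)     = map inj₂ (rays q)
  inc (idleᵛ _)    = []

  inc-complete : ∀ {v e} → e ∈ inc v ⇔ v ∈ members e
  inc-complete = mk⇔ (from ∈-members ∘ ⇒ _ _) (⇐ _ _ ∘ to ∈-members)
    where
    ⇒ : ∀ v e → e ∈ inc v → Incident v e
    ⇒ (edgeᵛ e) g g∈ with k , _ , refl ← ∈-map⁻ (λ k → inj₁ (e , k)) g∈ = refl
    ⇒ (colorᵛ u i) g g∈ with (e , k) , ch∈ , refl ← ∈-map⁻ inj₁ g∈ =
      let e∈ , eq = to ∈-choices ch∈ in to (incident-complete u e) e∈ , eq
    ⇒ (padᵛ q) g g∈ with s , s∈ , refl ← ∈-map⁻ inj₂ g∈ = to ∈-rays s∈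
    ⇐ : ∀ v e → Incident v e → e ∈ inc v
    ⇐ (edgeᵛ e) (inj₁ (f , k)) refl = ∈-map⁺ (λ k → inj₁ (e , k)) (∈-allFin k)
    ⇐ (colorᵛ u i) (inj₁ (f , k)) (u∈ , eq) =
        ∈-map⁺ inj₁ (from ∈-choices (from (incident-complete u f) u∈ , eq))
    ⇐ (padᵛ q) (inj₂ s) q∈ = ∈-map⁺ inj₂ (from ∈-rays q∈)

  choice≡ : ∀ {e f} {k : Slot e} {l : Slot f} → e ≡ f → colorAt e k ≡ colorAt f l →
      _≡_ {A = Choice} (e , k) (f , l)
  choice≡ {e} refl eq = cong (e ,_) (colorAt-injective eq)

  -- An edge vertex determines the edge and a color vertex the color, so one of each determines the
  -- choice. Two different color vertices in one hyperedge have the same color, hence different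
  -- owners, and these determine the edge because G is simple.
  linear : ∀ {v w} e f → v ≢ w → Incident v e → Incident w e → Incident v f → Incident w f → e ≡ f
  linear {edgeᵛ _} {edgeᵛ _} (inj₁ _) (inj₁ _) v≢w refl refl _ _ = ⊥-elim (v≢w refl)
  linear {edgeᵛ _} {colorᵛ _ _} (inj₁ _) (inj₁ _) v≢w refl (_ , eq) refl (_ , eq′) =
      cong inj₁ (choice≡ refl (trans (sym eq) eq′))
  linear {colorᵛ _ _} {edgeᵛ _} (inj₁ _) (inj₁ _) v≢w (_ , eq) refl (_ , eq′) refl =
      cong inj₁ (choice≡ refl (trans (sym eq) eq′))
  linear {colorᵛ u i} {colorᵛ v j} (inj₁ (e , k)) (inj₁ (f , l)) v≢w (u∈ , eq) (v∈ , eq₁) (u∈′ , eq′)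
      (v∈′ , _) with u Fin.≟ v
  ... | yes refl = ⊥-elim (v≢w (cong (colorᵛ u) (hue-injective (trans eq (sym eq₁)))))
  ... | no u≢v   = cong inj₁ (choice≡ (simple u≢v u∈ v∈ u∈′ v∈′) (trans (sym eq) eq′))
  linear {padᵛ q} {padᵛ q′} (inj₂ s) (inj₂ s′) v≢w q∈ q′∈ q∈′ q′∈′ =
    cong inj₂ (star-linear (v≢w ∘ cong padᵛ) q∈ q′∈ q∈′ q′∈′)

  members-injective : ∀ e f → (∀ {v} → Incident v e ⇔ Incident v f) → e ≡ f
  members-injective (inj₁ (e , k)) (inj₁ (f , l)) eq = cong inj₁ (choice≡ (to (eq {edgeᵛ e}) refl)
    (trans (sym (hue-hueAt (lo∈ e) k)) (proj₂
        (to (eq {colorᵛ (lo e) (hueAt (lo∈ e) k)}) (lo∈ e , hue-hueAt (lo∈ e) k)))))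
  members-injective (inj₁ (e , k)) (inj₂ s) eq = ⊥-elim (to (eq {edgeᵛ e}) refl)
  members-injective (inj₂ s) (inj₁ (e , k)) eq = ⊥-elim (from (eq {edgeᵛ e}) refl)
  members-injective (inj₂ s) (inj₂ s′) eq =
      cong inj₂ (star-injective λ {q} → mk⇔ (to (eq {padᵛ q})) (from (eq {padᵛ q})))

  line : LinearHypergraph V E
  line = record
    { members           = members
    ; members-unique    = members-unique
    ; members-nonempty  = λ { (inj₁ (e , k)) → edgeᵛ e , here refl ; (inj₂ q) →
        padᵛ q , ∈-map⁺ padᵛ (∈-star q) }
    ; members-injective = λ {e} {f} eq →
        members-injective e f (mk⇔ (to ∈-members ∘ to eq ∘ from ∈-members)
        (to ∈-members ∘ from eq ∘ from ∈-members))
    ; inc               = inc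
    ; inc-unique        = inc-unique
    ; inc-complete      = inc-complete
    ; linear            = λ {v} {w} {e} {f} v≢w v∈e w∈e v∈f w∈f →
                            linear e f v≢w (to ∈-members v∈e) (to ∈-members w∈e) (to ∈-members v∈f)
                                (to ∈-members w∈f)
    }
    where
    members-unique : ∀ e → Unique (members e)
    members-unique (inj₁ (e , k)) = ((λ ()) ∷ (λ ()) ∷ []) ∷ ((λ eq → lo≢hi e (owner eq)) ∷ []) ∷ [] ∷ []
      where
      owner : ∀ {u v i j} → _≡_ {A = V} (colorᵛ u i) (colorᵛ v j) → u ≡ v
      owner refl = refl
    members-unique (inj₂ q) = Unique.map⁺ (λ { refl → refl }) (star-unique q)
    inc-unique : ∀ v → Unique (inc v)
    inc-unique (edgeᵛ e)    = Unique.map⁺ (λ { refl → refl }) (Unique.allFin⁺ _)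
    inc-unique (colorᵛ u i) = Unique.map⁺ (λ { refl → refl }) (choices-unique (hue u i) (incident-unique u))
    inc-unique (padᵛ q)     = Unique.map⁺ (λ { refl → refl }) (rays-unique q)
    inc-unique (idleᵛ q)    = []

  spread : ℕ
  spread = total (λ u → length (hues u))

  edgeCount : ℕ
  edgeCount = total (λ e → length (colors e)) + p

  E↔ : E ↔ Fin edgeCount
  E↔ = ↔-trans (Σ↔ (λ e → length (colors e)) ⊎-↔ ↔-refl) (↔-sym Fin.+↔⊎)

  V↔ : V ↔ Fin (size + (spread + (p + r)))
  V↔ = ↔-trans (↔-refl ⊎-↔ ↔-trans (Σ↔ (λ u → length (hues u)) ⊎-↔ ↔-sym Fin.+↔⊎) (↔-sym Fin.+↔⊎))
      (↔-sym Fin.+↔⊎)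

  -- For edge and color vertices, every component is known to the nodes that run them, at the latest
  -- after one exchange. The palette index is less than the number of vertices, whereas the color
  -- itself is unbounded.
  code : V → ℕ × ℕ × ℕ
  code (edgeᵛ e)         = 0 , identifier (lo e) , identifier (hi e)
  code (colorᵛ u i)      = 1 , identifier u , toℕ i
  code (inj₂ (inj₂ q))   = 2 , toℕ (Fin.join p r q) , 0

  code-injective : ∀ {v w} → code v ≡ code w → v ≡ w
  code-injective {edgeᵛ e} {edgeᵛ f} eq = cong edgeᵛ (simple (lo≢hi e) (lo∈ e) (hi∈ e)
    (from ∈-edge (inj₁ (identifier-unique (cong (proj₁ ∘ proj₂) eq))))
    (from ∈-edge (inj₂ (identifier-unique (cong (proj₂ ∘ proj₂) eq)))))
  code-injective {colorᵛ u i} {colorᵛ v j} eq with refl ← identifier-unique {u} {v} (cong (proj₁ ∘ proj₂) eq) =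
    cong (colorᵛ u) (Fin.toℕ-injective (cong (proj₂ ∘ proj₂) eq))
  code-injective {inj₂ (inj₂ q)} {inj₂ (inj₂ s)} eq = cong (inj₂ ∘ inj₂) (trans (sym (Fin.splitAt-join p r q))
    (trans (cong (Fin.splitAt p) (Fin.toℕ-injective (cong (proj₁ ∘ proj₂) eq))) (Fin.splitAt-join p r s)))
  code-injective {edgeᵛ _}       {colorᵛ _ _}     ()
  code-injective {edgeᵛ _}       {inj₂ (inj₂ _)}  ()
  code-injective {colorᵛ _ _}    {edgeᵛ _}        ()
  code-injective {colorᵛ _ _}    {inj₂ (inj₂ _)}  ()
  code-injective {inj₂ (inj₂ _)} {edgeᵛ _}        ()
  code-injective {inj₂ (inj₂ _)} {colorᵛ _ _}     ()

  ident : V → ℕ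
  ident v = let t , a , b = code v in tagged t a b

  ident-injective : ∀ {v w} → ident v ≡ ident w → v ≡ w
  ident-injective {v} {w} eq with t , a , b ← code v in v≡ | t′ , a′ , b′ ← code w in w≡
    with refl , refl , refl ← tagged-injective {t} {a} {b} {t′} {a′} {b′} eq =
        code-injective (trans v≡ (sym w≡))

  -- With M the logarithm of N, identifiers of G have at most κ M bits, as n ≤ N, and indices below
  -- N at most M, so k = (κ + 1) M bounds both. Tagging gives 4 k + 6, and M ≥ 1 absorbs the 6 into
  -- 6 M, whence 4 κ + 10.
  ident-length : ∀ {N} → size + (spread + (p + r)) ≡ N → 2 * n ≤ N → 1 ≤ n → ∀ v →
      bitLength (ident v) ≤ (4 * κ + 10) * ⌈log₂ N ⌉
  ident-length {N} N≡ 2n≤N 1≤n v = <2^⇒bitLength≤ {ident v} (ℕ.<-≤-trans (bounded v) (ℕ.^-monoʳ-≤ 2 exponent))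
    where
    M k : ℕ
    M = ⌈log₂ N ⌉
    k = suc κ * M
    1≤M : 1 ≤ M
    1≤M = Log.⌈log₂⌉-mono-≤ {2} (ℕ.≤-trans (ℕ.*-monoʳ-≤ 2 1≤n) 2n≤N)
    exponent : 4 * k + 6 ≤ (4 * κ + 10) * M
    exponent = begin
      4 * (suc κ * M) + 6       ≤⟨ ℕ.+-monoʳ-≤ (4 * k) (ℕ.*-monoʳ-≤ 6 1≤M) ⟩
      4 * (suc κ * M) + 6 * M   ≡⟨ solve 2 (λ κ M → con 4 :* ((con 1 :+ κ) :* M) :+ con 6 :* M :=
          (con 4 :* κ :+ con 10) :* M) refl κ M ⟩
      (4 * κ + 10) * M          ∎
      where open ℕ.≤-Reasoning; open +-*-Solver
    identifier< : ∀ u → identifier u < 2 ^ k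
    identifier< u = ℕ.<-≤-trans (bitLength≤⇒<2^ (identifier-length u)) (ℕ.^-monoʳ-≤ 2
      (ℕ.≤-trans (ℕ.*-monoʳ-≤ κ (Log.⌈log₂⌉-mono-≤ (ℕ.≤-trans (ℕ.m≤m+n n (n + 0)) 2n≤N))) (ℕ.m≤n+m (κ * M) M)))
    index< : ∀ {a i} → i < a → a ≤ N → i < 2 ^ k
    index< i<a a≤N = ℕ.<-≤-trans i<a (ℕ.≤-trans a≤N
        (ℕ.≤-trans (n≤2^⌈log₂n⌉ N) (ℕ.^-monoʳ-≤ 2 (ℕ.m≤m+n M (κ * M)))))
    spread≤N : spread + (p + r) ≤ N
    spread≤N = subst (spread + (p + r) ≤_) N≡ (ℕ.m≤n+m _ size)
    bounded : ∀ v → ident v < 2 ^ (4 * k + 6)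
    bounded (edgeᵛ e) = tagged<2^ k {0} {identifier (lo e)} {identifier (hi e)} (s≤s z≤n) (identifier< (lo e))
        (identifier< (hi e))
    bounded (colorᵛ u i) = tagged<2^ k {1} {identifier u} {toℕ i} (s≤s (s≤s z≤n)) (identifier< u)
      (index< (Fin.toℕ<n i) (ℕ.≤-trans (≤total (λ u → length (hues u)) u)
          (ℕ.≤-trans (ℕ.m≤m+n spread (p + r)) spread≤N)))
    bounded (inj₂ (inj₂ q)) = tagged<2^ k {2} {toℕ (Fin.join p r q)} {0} (s≤s (s≤s (s≤s z≤n)))
      (index< (Fin.toℕ<n (Fin.join p r q)) (ℕ.≤-trans (ℕ.m≤n+m (p + r) spread) spread≤N)) (ℕ.m^n>0 2 k)

-- The simulation

containing : ℕ → List (List ℕ) → ℕ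
containing c ls = length (filter (c ∈?_) ls)

-- The port of (u , c) that belongs to the edge at port j of u: only the earlier edges whose lists
-- contain c occupy a port.
localRank : ℕ → ℕ → List (List ℕ) → ℕ
localRank c j ls = containing c (take j ls)

-- Pairs of the index of a list containing c, counted from j, and the index of c in it.
occurrences : ℕ → ℕ → List (List ℕ) → List (ℕ × ℕ)
occurrences c j [] = []
occurrences c j (l ∷ ls) with c ∈? l
... | yes c∈ = (j , toℕ (Any.index c∈)) ∷ occurrences c (suc j) ls
... | no _   = occurrences c (suc j) ls

indexOf : ℕ → List ℕ → ℕ
indexOf c l with c ∈? l
... | yes c∈ = toℕ (Any.index c∈)
... | no _   = 0

firstWith : (ℕ → Bool) → List ℕ → ℕ
firstWith p []       = 0
firstWith p (c ∷ cs) = if p c then c else firstWith p cs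

-- The incidence part of the view of an edge or color vertex of degree k: each of its hyperedges has
-- exactly two other endpoints.
pairs : ℕ → List (⊤ × List ℕ)
pairs k = map (tt ,_) (segments 0 (replicate k 2))

module Simulation (𝒜 : Algorithm ⊤ Bool) where
  open Algorithm 𝒜

  -- A node u runs the vertices (u , c), for all colors c at once, and, for each
  -- of its edges, the vertex e.  The identifier of e involves that of the other
  -- endpoint, so the state of e is kept as a function of the latter; the
  -- argument becomes known with the first message.
  record Local : Set where
    field
      self    : ℕ
      inputs  : List (List ℕ)
      colored : ℕ → State
      decided : ℕ → Maybe (List Bool)
      link    : ℕ → ℕ → State

  open Local

  -- The identifier of the sender and, for each color c, the message of its vertex (u , c). Messages
  -- of the vertex `e` need no transport, since the receiver runs `e` as well. The identifier
  -- travels in every round because it also decides the order of the messages to `e`.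
  Packet : Set
  Packet = ℕ × (ℕ → Message)

  start : LocalView (List ℕ) → Local
  start (localView i incident) = record
    { self    = i
    ; inputs  = ls
    ; colored = colored₀
    ; decided = output ∘ colored₀
    ; link    = λ j i′ → init (localView (tagged 0 (i ⊓ i′) (i ⊔ i′)) (pairs (length (at [] ls j))))
    }
    where
    ls : List (List ℕ)
    ls = map proj₁ incident
    colored₀ : ℕ → State
    colored₀ c = init (localView (tagged 1 i (indexOf c (palette ls))) (pairs (containing c ls)))

  packet : Local → ℕ → Packet
  packet s j = self s , λ c → send (colored s c) (localRank c j (inputs s))

  -- Every port receives exactly one packet, so the default is never used.
  heard : Local → List (List Packet) → ℕ → Packet
  heard s inbox j = at (packet s j) (concat inbox) j

  linked : Local → List (List Packet) → ℕ → State
  linked s inbox j = link s j (proj₁ (heard s inbox j))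

  -- The order is that of `members`: first the vertex `e`, which is run locally and whose port for
  -- the color is the index of the color in its list, then the color vertex of the other endpoint.
  coloredDelivery : Local → List (List Packet) → ℕ → ℕ × ℕ → List Message
  coloredDelivery s inbox c (j , k) = send (linked s inbox j) k ∷ proj₂ (heard s inbox j) c ∷ []

  coloredInbox : Local → List (List Packet) → ℕ → List (List Message)
  coloredInbox s inbox c = map (coloredDelivery s inbox c) (occurrences c 0 (inputs s))

  -- Both endpoints have to feed the same list to their copies of the vertex `e`, so the smaller
  -- identifier goes first, as in `members`.
  linkDelivery : Local → List (List Packet) → ℕ → ℕ → List Message
  linkDelivery s inbox j c = if does (self s ℕ.≤? proj₁ (heard s inbox j))
    then proj₂ (packet s j) c ∷ proj₂ (heard s inbox j) c ∷ []
    else proj₂ (heard s inbox j) c ∷ proj₂ (packet s j) c ∷ []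

  linkInbox : Local → List (List Packet) → ℕ → List (List Message)
  linkInbox s inbox j = map (linkDelivery s inbox j) (at [] (inputs s) j)

  step : Local → List (List Packet) → Local
  step s inbox = record
    { self    = self s
    ; inputs  = inputs s
    ; colored = colored⁺
    ; decided = λ c → decided s c <∣> output (colored⁺ c)
    -- The true identifier has now been inserted, and from here on the state is constant in the
    -- argument.
    ; link    = λ j _ → receive (linked s inbox j) (linkInbox s inbox j)
    }
    where
    colored⁺ : ℕ → State
    colored⁺ c = receive (colored s c) (coloredInbox s inbox c)

  chosen : Local → ℕ → ℕ → Bool
  chosen s j c = maybe′ (λ bs → at false bs (localRank c j (inputs s))) false (decided s c)

  picks : Local → ℕ → List (List ℕ) → List ℕ
  picks s j []       = []
  picks s j (l ∷ ls) = firstWith (chosen s j) l ∷ picks s (suc j) ls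

  -- An output is final, so u waits for all of its color vertices. It does not wait for the edge
  -- vertices, whose decisions can be read off from those of the color vertices.
  Ready : Local → Set
  Ready s = All (λ c → is-just (decided s c) ≡ true) (palette (inputs s))

  ready? : ∀ s → Dec (Ready s)
  ready? s = All.all? (λ c → is-just (decided s c) Bool.≟ true) (palette (inputs s))

  result : Local → Maybe (List ℕ)
  result s = if does (ready? s) then just (picks s 0 (inputs s)) else nothing

  result-ready : ∀ {s} → Ready s → result s ≡ just (picks s 0 (inputs s))
  result-ready {s} ready = cong (if_then just (picks s 0 (inputs s)) else nothing) (dec-true (ready? s) ready)

  result-unready : ∀ {s} → ¬ Ready s → result s ≡ nothing
  result-unready {s} unready = cong (if_then just (picks s 0 (inputs s)) else nothing)
      (dec-false (ready? s) unready)

  ℬ : Algorithm (List ℕ) ℕ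
  ℬ = record { State = Local ; Message = Packet ; init = start ; send = packet ; receive = step ; output =
      result }

-- Correctness of the simulation

position-tabulate : ∀ {m} {f : Fin m → Fin n} → (∀ {k l} → f k ≡ f l → k ≡ l) → ∀ k →
    position (f k) (tabulate f) ≡ toℕ k
position-tabulate {f = f} f-inj zero    = position-here (f zero) (tabulate (f ∘ suc))
position-tabulate {f = f} f-inj (suc k) =
    trans (position-there (tabulate (f ∘ suc)) (λ eq → case f-inj eq of λ ()))
  (cong suc (position-tabulate (Fin.suc-injective ∘ f-inj) k))

map-const : {f : A → B} {b : B} {xs : List A} → (∀ {x} → x ∈ xs → f x ≡ b) → map f xs ≡ replicate (length xs) b
map-const {xs = []}     eq = refl
map-const {xs = x ∷ xs} eq = cong₂ _∷_ (eq (here refl)) (map-const (eq ∘ there))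

indexOf-lookup : ∀ {l} → Unique l → ∀ i → indexOf (lookup l i) l ≡ toℕ i
indexOf-lookup {l} u i with lookup l i ∈? l
... | yes c∈ = cong toℕ (lookup-injective u (sym (Any.lookup-index c∈)))
... | no c∉  = ⊥-elim (c∉ (∈-lookup i))

module Correctness {n : ℕ} (G : Hypergraph n) (isGraph : IsGraph G) {κ : ℕ} (net : Network κ G)
                   (L : ListAssignment G) (p r : ℕ)
                   {N s κ′ : ℕ} (V↔ : Line.V G isGraph net L p r ↔ Fin N)
                       (E↔ : Line.E G isGraph net L p r ↔ Fin s)
                   (ident-length : ∀ v → bitLength (Line.ident G isGraph net L p r v) ≤ κ′ * ⌈log₂ N ⌉)
                   (𝒜 : Algorithm ⊤ Bool) where
  open Hypergraph G
  open Network net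
  open ListAssignment L
  open Graph G isGraph net
  open Line G isGraph net L p r hiding (V↔; E↔; ident-length)
  open Realization line V↔ E↔
  open Algorithm 𝒜
  open Simulation 𝒜
  open Local
  module ℬ-run = Execution ℬ net colors
  open Labelled κ′ ident ident-injective ident-length
  open Run 𝒜
  module 𝒜-run = Execution 𝒜 network (λ _ → tt)

  local : ℕ → Fin n → Local
  local = ℬ-run.state

  oth-edgeᵛ : ∀ e k → oth (edgeᵛ e) (inj₁ (e , k)) ≡ colorᵛ (lo e) (hueAt (lo∈ e) k) ∷ colorᵛ (hi e)
      (hueAt (hi∈ e) k) ∷ []
  oth-edgeᵛ e k = trans (filter-reject (λ w → ¬? (w ≟ᵛ edgeᵛ e)) (λ ≢ → ≢ refl))
      (filter-all (λ w → ¬? (w ≟ᵛ edgeᵛ e)) ((λ ()) ∷ (λ ()) ∷ []))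

  owner≢ : ∀ {u v i j} → u ≢ v → _≢_ {A = V} (colorᵛ u i) (colorᵛ v j)
  owner≢ u≢v refl = u≢v refl

  -- A color has unrelated indices in the palettes of the two endpoints; `j` is the one on the other
  -- side. The edge vertex comes first whichever endpoint u is.
  oth-colorᵛ : ∀ {u i e k} → u ∈ˢ edge e → hue u i ≡ colorAt e k →
    ∃[ j ] (hue (other u e) j ≡ colorAt e k × oth (colorᵛ u i) (inj₁ (e , k)) ≡ edgeᵛ e ∷ colorᵛ
        (other u e) j ∷ [])
  oth-colorᵛ {u} {i} {e} {k} u∈ eq = Sum.[ at-lo , at-hi ]′ (to ∈-edge u∈)
    where
    P? : (v w : V) → Dec (w ≢ v)
    P? v w = ¬? (w ≟ᵛ v)
    Goal : (u v : Fin n) (i : Fin (length (hues u))) → Set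
    Goal u v i = ∃[ j ] (hue v j ≡ colorAt e k × oth (colorᵛ u i) (inj₁ (e , k)) ≡ edgeᵛ e ∷ colorᵛ v j ∷ [])
    low high : V
    low  = colorᵛ (lo e) (hueAt (lo∈ e) k)
    high = colorᵛ (hi e) (hueAt (hi∈ e) k)
    oth-low : oth low (inj₁ (e , k)) ≡ edgeᵛ e ∷ high ∷ []
    oth-low = trans (filter-accept (P? low) (λ ())) (cong (edgeᵛ e ∷_)
      (trans (filter-reject (P? low) (λ ≢ → ≢ refl)) (filter-accept (P? low) (owner≢ (≢-sym (lo≢hi e))))))
    oth-high : oth high (inj₁ (e , k)) ≡ edgeᵛ e ∷ low ∷ []
    oth-high = trans (filter-accept (P? high) (λ ())) (cong (edgeᵛ e ∷_)
      (trans (filter-accept (P? high) (owner≢ (lo≢hi e)))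
          (cong (low ∷_) (filter-reject (P? high) (λ ≢ → ≢ refl)))))
    at-lo : u ≡ lo e → Goal u (other u e) i
    at-lo refl = subst₂ (Goal (lo e)) (sym (other-lo e))
        (hue-injective {lo e} (trans (hue-hueAt (lo∈ e) k) (sym eq)))
      (hueAt (hi∈ e) k , hue-hueAt (hi∈ e) k , oth-low)
    at-hi : u ≡ hi e → Goal u (other u e) i
    at-hi refl = subst₂ (Goal (hi e)) (sym (other-hi e))
        (hue-injective {hi e} (trans (hue-hueAt (hi∈ e) k) (sym eq)))
      (hueAt (lo∈ e) k , hue-hueAt (lo∈ e) k , oth-high)

  containing-choices : ∀ c es → length (choices c es) ≡ containing c (map colors es)
  containing-choices c [] = refl
  containing-choices c (e ∷ es) with c ∈? colors e
  ... | yes _ = cong suc (containing-choices c es)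
  ... | no _  = containing-choices c es

  port-edgeᵛ : ∀ e k → portOf (inj₁ (e , k)) (edgeᵛ e) ≡ toℕ k
  port-edgeᵛ e k = trans (cong (position (toE (inj₁ (e , k))))
      (trans (sym (map-∘ (allFin _))) (map-tabulate id (λ k → toE (inj₁ (e , k))))))
    (position-tabulate (λ eq → slot≡ (toE-injective eq)) k)
    where
    slot≡ : ∀ {k l} → _≡_ {A = E} (inj₁ (e , k)) (inj₁ (e , l)) → k ≡ l
    slot≡ refl = refl

  -- Along `incident u`, each edge before `e` contributes one hyperedge if its list contains the
  -- color and none otherwise, which is what `localRank` counts.
  port-colorᵛ : ∀ {u i e k} → u ∈ˢ edge e → hue u i ≡ colorAt e k →
    portOf (inj₁ (e , k)) (colorᵛ u i) ≡ localRank (hue u i) (position e (incident u)) (lists u)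
  port-colorᵛ {u} {i} {e} {k} u∈ eq = go (incident u) (from (incident-complete u e) u∈)
    where
    c : ℕ
    c = hue u i
    go : ∀ es → e ∈ es → position (toE (inj₁ (e , k))) (map toE (map inj₁ (choices c es))) ≡ localRank c
        (position e es) (map colors es)
    go (f ∷ es) e∈ with e Fin.≟ f
    go (e ∷ es) e∈ | yes refl with c ∈? colors e
    ... | yes c∈ = trans (cong (λ l → position (toE (inj₁ (e , k)))
        (toE (inj₁ (e , l)) ∷ map toE (map inj₁ (choices c es))))
                           (colorAt-injective (trans (sym (Any.lookup-index c∈)) eq)))
                         (position-here (toE (inj₁ (e , k))) (map toE (map inj₁ (choices c es))))
    ... | no c∉  = ⊥-elim (c∉ (subst (_∈ colors e) (sym eq) (∈-lookup k)))
    go (f ∷ es) (here e≡f)  | no e≢f = ⊥-elim (e≢f e≡f)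
    go (f ∷ es) (there e∈) | no e≢f with c ∈? colors f
    ... | yes c∈ = trans (position-there (map toE (map inj₁ (choices c es)))
        (λ toE≡ → e≢f (owner≡ (toE-injective toE≡)))) (cong suc (go es e∈))
      where
      owner≡ : ∀ {l} → _≡_ {A = E} (inj₁ (e , k)) (inj₁ (f , l)) → e ≡ f
      owner≡ refl = refl
    ... | no _   = go es e∈

  -- Both lists arise by the same scan of the edges, one in port numbers as the node sees it, the
  -- other in actual edges. Comparing them only after `map` reduces equality of inboxes to equality
  -- of single deliveries; `a` is the port reached so far.
  occurrences-choices : ∀ {C : Set} {c} (g : ℕ × ℕ → C) (h : Choice → C) {es} a → Unique es →
    (∀ {e k} → e ∈ es → c ≡ colorAt e k → g (a + position e es , toℕ k) ≡ h (e , k)) →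
    map g (occurrences c a (map colors es)) ≡ map h (choices c es)
  occurrences-choices g h {[]} a u eq = refl
  occurrences-choices {c = c} g h {e ∷ es} a (e∉ ∷ u) eq with c ∈? colors e
  ... | yes c∈ = cong₂ _∷_ (trans (cong (λ j → g (j , toℕ (Any.index c∈)))
      (trans (sym (ℕ.+-identityʳ a)) (cong (a +_) (sym (position-here e es)))))
                              (eq (here refl) (Any.lookup-index c∈)))
                   (occurrences-choices g h (suc a) u (λ {f} {k} f∈ c≡ →
                     trans (cong (λ j → g (j , toℕ k)) (shift f∈)) (eq (there f∈) c≡)))
    where
    shift : ∀ {f} → f ∈ es → suc a + position f es ≡ a + position f (e ∷ es)
    shift {f} f∈ = trans (sym (ℕ.+-suc a (position f es)))
        (cong (a +_) (sym (position-there es (≢-sym (All.lookup e∉ f∈)))))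
  ... | no _   = occurrences-choices g h (suc a) u (λ {f} {k} f∈ c≡ →
                     trans (cong (λ j → g (j , toℕ k)) (shift f∈)) (eq (there f∈) c≡))
    where
    shift : ∀ {f} → f ∈ es → suc a + position f es ≡ a + position f (e ∷ es)
    shift {f} f∈ = trans (sym (ℕ.+-suc a (position f es)))
        (cong (a +_) (sym (position-there es (≢-sym (All.lookup e∉ f∈)))))

  inputs-local : ∀ t u → inputs (local t u) ≡ lists u
  inputs-local zero    u = sym (map-∘ (incident u))
  inputs-local (suc t) u = inputs-local t u

  self-local : ∀ t u → self (local t u) ≡ identifier u
  self-local zero    u = refl
  self-local (suc t) u = self-local t u

  view-edgeᵛ : ∀ e → 𝒜-run.view (toV (edgeᵛ e)) ≡ localView (ident (edgeᵛ e)) (pairs (length (colors e)))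
  view-edgeᵛ e = trans (view-toV (edgeᵛ e))
      (cong (λ ls → localView (ident (edgeᵛ e)) (map (tt ,_) (segments 0 ls)))
    (trans (map-const length≡2) (cong (λ l → replicate l 2)
        (trans (length-map _ (allFin (length (colors e)))) (length-tabulate {n = length (colors e)} id)))))
    where
    length≡2 : ∀ {g} → g ∈ inc (edgeᵛ e) → length (oth (edgeᵛ e) g) ≡ 2
    length≡2 g∈ with k , _ , refl ← ∈-map⁻ (λ k → inj₁ (e , k)) g∈ = cong length (oth-edgeᵛ e k)

  view-colorᵛ : ∀ u i → 𝒜-run.view (toV (colorᵛ u i)) ≡ localView (ident (colorᵛ u i))
      (pairs (containing (hue u i) (lists u)))
  view-colorᵛ u i = trans (view-toV (colorᵛ u i))
      (cong (λ ls → localView (ident (colorᵛ u i)) (map (tt ,_) (segments 0 ls)))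
    (trans (map-const length≡2) (cong (λ l → replicate l 2)
        (trans (length-map inj₁ (choices (hue u i) (incident u)))
        (containing-choices (hue u i) (incident u))))))
    where
    length≡2 : ∀ {g} → g ∈ inc (colorᵛ u i) → length (oth (colorᵛ u i) g) ≡ 2
    length≡2 g∈ with (e , k) , ch∈ , refl ← ∈-map⁻ inj₁ g∈ with e∈ , eq ← to ∈-choices ch∈
      with _ , _ , oth≡ ← oth-colorᵛ {u} {i} {e} {k} (to (incident-complete u e) e∈) eq = cong length oth≡

  mailbox : ℕ → Fin n → List (List Packet)
  mailbox t u = ℬ-run.inbox (local t) u

  -- An edge of a graph has one other endpoint, so every entry of the mailbox is a singleton and
  -- concatenation preserves the port numbers.
  heard-other : ∀ t {u e} → u ∈ˢ edge e → heard (local t u) (mailbox t u) (position e (incident u)) ≡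
                packet (local t (other u e)) (position e (incident (other u e)))
  heard-other t {u} {e} u∈ = trans (cong
      (λ ps → at (packet (local t u) (position e (incident u))) ps (position e (incident u))) flat)
    (at-position _ sent (from (incident-complete u e) u∈))
    where
    sent : Fin size → Packet
    sent f = packet (local t (other u f)) (position f (incident (other u f)))
    flat : concat (mailbox t u) ≡ map sent (incident u)
    flat = trans (cong concat (trans
      (map-cong-local (All.tabulate λ {f} f∈ → cong (map _) (others≡ (to (incident-complete u f) f∈))))
      (map-∘ (incident u)))) (concat-map-[ map sent (incident u) ])

  -- The state of an edge vertex is claimed only at the identifier of the actual other endpoint,
  -- which is the argument that `linked` supplies.
  record Simulates (t : ℕ) : Set where
    field
      colored≡ : ∀ u i → colored (local t u) (hue u i) ≡ stateOf t (colorᵛ u i)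
      link≡    : ∀ {u e} → u ∈ˢ edge e →
                 link (local t u) (position e (incident u)) (identifier (other u e)) ≡ stateOf t (edgeᵛ e)

  module Step {t : ℕ} (sim : Simulates t) where
    open Simulates sim

    spoken : ∀ {u i e k} → u ∈ˢ edge e → hue u i ≡ colorAt e k →
      proj₂ (packet (local t u) (position e (incident u))) (colorAt e k) ≡ send (stateOf t (colorᵛ u i))
          (portOf (inj₁ (e , k)) (colorᵛ u i))
    spoken {u} {i} {e} {k} u∈ eq = cong₂ send
      (trans (cong (colored (local t u)) (sym eq)) (colored≡ u i))
      (trans (cong₂ (λ c ls → localRank c (position e (incident u)) ls) (sym eq) (inputs-local t u))
          (sym (port-colorᵛ u∈ eq)))

    linked≡ : ∀ {u e} → u ∈ˢ edge e → linked (local t u) (mailbox t u) (position e (incident u)) ≡ stateOf t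
        (edgeᵛ e)
    linked≡ {u} {e} u∈ = trans (cong (link (local t u) (position e (incident u)))
      (trans (cong proj₁ (heard-other t u∈)) (self-local t (other u e)))) (link≡ u∈)

    delivery : V → E → List Message
    delivery v g = map (λ w → send (stateOf t w) (portOf g w)) (oth v g)

    colored-suc : ∀ u i → colored (local (suc t) u) (hue u i) ≡ stateOf (suc t) (colorᵛ u i)
    colored-suc u i = trans (cong₂ receive (colored≡ u i) (begin
      coloredInbox (local t u) (mailbox t u) (hue u i)
        ≡⟨ cong (λ ls → map (coloredDelivery (local t u) (mailbox t u) (hue u i)) (occurrences (hue u i) 0 ls))
            (inputs-local t u) ⟩
      map (coloredDelivery (local t u) (mailbox t u) (hue u i)) (occurrences (hue u i) 0 (lists u))
        ≡⟨ occurrences-choices (coloredDelivery (local t u) (mailbox t u) (hue u i))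
            (delivery (colorᵛ u i) ∘ inj₁) 0 (incident-unique u) (λ {e} {k} → same {e} {k}) ⟩
      map (delivery (colorᵛ u i) ∘ inj₁) (choices (hue u i) (incident u))
        ≡⟨ map-∘ (choices (hue u i) (incident u)) ⟩
      map (delivery (colorᵛ u i)) (inc (colorᵛ u i)) ∎)) (sym (stateOf-suc t (colorᵛ u i)))
      where
      open ≡-Reasoning
      same : ∀ {e k} → e ∈ incident u → hue u i ≡ colorAt e k →
        coloredDelivery (local t u) (mailbox t u) (hue u i) (position e (incident u) , toℕ k) ≡ delivery
            (colorᵛ u i) (inj₁ (e , k))
      same {e} {k} e∈ eq =
        let u∈ = to (incident-complete u e) e∈
            j , hue≡ , oth≡ = oth-colorᵛ {u} {i} {e} {k} u∈ eq
        in trans (cong₂ (λ x y → x ∷ y ∷ [])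
             (cong₂ send (linked≡ u∈) (sym (port-edgeᵛ e k)))
             (trans (cong₂ (λ q c → proj₂ q c) (heard-other t u∈) eq) (spoken (other-∈ u∈) hue≡)))
             (cong (map (λ w → send (stateOf t w) (portOf (inj₁ (e , k)) w))) (sym oth≡))

    link-suc : ∀ {u e} → u ∈ˢ edge e →
      link (local (suc t) u) (position e (incident u)) (identifier (other u e)) ≡ stateOf (suc t) (edgeᵛ e)
    link-suc {u} {e} u∈ = trans (cong₂ receive (linked≡ u∈) (begin
      linkInbox (local t u) (mailbox t u) (position e (incident u))
        ≡⟨ cong (map deliver) (trans (cong (λ ls → at [] ls (position e (incident u))) (inputs-local t u))
             (trans (at-position [] colors (from (incident-complete u e) u∈))
                 (trans (sym (tabulate-lookup (colors e))) (sym (map-tabulate id (colorAt e)))))) ⟩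
      map deliver (map (colorAt e) (allFin (length (colors e))))
        ≡⟨ map-∘ (allFin (length (colors e))) ⟨
      map (deliver ∘ colorAt e) (allFin (length (colors e)))
        ≡⟨ map-cong same (allFin (length (colors e))) ⟩
      map (λ k → delivery (edgeᵛ e) (inj₁ (e , k))) (allFin (length (colors e)))
        ≡⟨ map-∘ (allFin (length (colors e))) ⟩
      map (delivery (edgeᵛ e)) (inc (edgeᵛ e)) ∎)) (sym (stateOf-suc t (edgeᵛ e)))
      where
      open ≡-Reasoning
      me them : Packet
      me = packet (local t u) (position e (incident u))
      them = heard (local t u) (mailbox t u) (position e (incident u))
      v : Fin n
      v = other u e
      self≡ : self (local t u) ≡ identifier u
      self≡ = self-local t u
      them≡ : proj₁ them ≡ identifier v
      them≡ = trans (cong proj₁ (heard-other t u∈)) (self-local t v)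
      foreign : ∀ k → proj₂ them (colorAt e k) ≡ proj₂ (packet (local t v) (position e (incident v)))
          (colorAt e k)
      foreign k = cong (λ q → proj₂ q (colorAt e k)) (heard-other t u∈)
      sent : Slot e → Fin n → Message
      sent k w = proj₂ (packet (local t w) (position e (incident w))) (colorAt e k)
      deliver : ℕ → List Message
      deliver = linkDelivery (local t u) (mailbox t u) (position e (incident u))
      arrange : List Message → List Message → Bool → List Message
      arrange xs ys b = if b then xs else ys
      -- From either endpoint, the comparison of identifiers puts the message of `lo e` first; what
      -- is sent locally at one end is received at the other.
      arranged : ∀ k → deliver (colorAt e k) ≡ sent k (lo e) ∷ sent k (hi e) ∷ []
      arranged k with other-cases u∈
      ... | inj₁ (u≡ , v≡) = trans (cong (arrange _ (proj₂ them (colorAt e k) ∷ proj₂ me (colorAt e k) ∷ []))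
          (dec-true (self (local t u) ℕ.≤? proj₁ them)
              (subst₂ _≤_ (sym (trans self≡ (cong identifier u≡))) (sym (trans them≡ (cong identifier v≡)))
                  (ℕ.<⇒≤ (lo<hi e)))))
            (cong₂ (λ x y → x ∷ y ∷ []) (cong (sent k) u≡) (trans (foreign k) (cong (sent k) v≡)))
      ... | inj₂ (u≡ , v≡) = trans (cong (arrange (proj₂ me (colorAt e k) ∷ proj₂ them (colorAt e k) ∷ []) _)
          (dec-false (self (local t u) ℕ.≤? proj₁ them)
              (λ u≤v → ℕ.<⇒≱ (lo<hi e) (subst₂ _≤_ (trans self≡ (cong identifier u≡))
                  (trans them≡ (cong identifier v≡)) u≤v))))
            (cong₂ (λ x y → x ∷ y ∷ []) (trans (foreign k) (cong (sent k) v≡)) (cong (sent k) u≡))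
      same : ∀ k → deliver (colorAt e k) ≡ delivery (edgeᵛ e) (inj₁ (e , k))
      same k = trans (arranged k) (trans
        (cong₂ (λ x y → x ∷ y ∷ []) (spoken (lo∈ e) (hue-hueAt (lo∈ e) k))
            (spoken (hi∈ e) (hue-hueAt (hi∈ e) k)))
        (cong (map (λ w → send (stateOf t w) (portOf (inj₁ (e , k)) w))) (sym (oth-edgeᵛ e k))))

  simulates : ∀ t → Simulates t
  simulates zero = record
    { colored≡ = λ u i → cong init (trans (cong₂ (λ x k → localView (tagged 1 (identifier u) x) (pairs k))
        (trans (cong (λ ls → indexOf (hue u i) (palette ls)) (inputs-local 0 u))
            (indexOf-lookup (palette-unique (lists u)) i))
        (cong (containing (hue u i)) (inputs-local 0 u))) (sym (view-colorᵛ u i)))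
    ; link≡ = λ {u} {e} u∈ → cong init (trans (cong₂ (λ x k → localView x (pairs k)) (name u∈)
        (cong length (trans (cong (λ ls → at [] ls (position e (incident u))) (inputs-local 0 u))
            (at-position [] colors (from (incident-complete u e) u∈)))))
        (sym (view-edgeᵛ e)))
    }
    where
    -- Minimum and maximum are symmetric, so the two endpoints compute the same identifier, and
    -- these are the identifiers of `lo e` and `hi e`.
    name : ∀ {u e} → u ∈ˢ edge e →
      tagged 0 (identifier u ⊓ identifier (other u e)) (identifier u ⊔ identifier (other u e)) ≡ ident (edgeᵛ e)
    name {u} {e} u∈ with other-cases u∈
    ... | inj₁ (u≡ , v≡) rewrite u≡ | other-lo e =
        cong₂ (tagged 0) (ℕ.m≤n⇒m⊓n≡m (ℕ.<⇒≤ (lo<hi e))) (ℕ.m≤n⇒m⊔n≡n (ℕ.<⇒≤ (lo<hi e)))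
    ... | inj₂ (u≡ , v≡) rewrite u≡ | other-hi e =
        cong₂ (tagged 0) (ℕ.m≥n⇒m⊓n≡n (ℕ.<⇒≤ (lo<hi e))) (ℕ.m≥n⇒m⊔n≡m (ℕ.<⇒≤ (lo<hi e)))
  simulates (suc t) = record { colored≡ = colored-suc ; link≡ = link-suc }
    where open Step (simulates t)

  decided≡ : ∀ t u i → decided (local t u) (hue u i) ≡ 𝒜-run.decision t (toV (colorᵛ u i))
  decided≡ zero    u i = cong output (Simulates.colored≡ (simulates 0) u i)
  decided≡ (suc t) u i = cong₂ _<∣>_ (decided≡ t u i) (cong output (Simulates.colored≡ (simulates (suc t)) u i))

-- From matchings to colorings

module Coloring {n : ℕ} (G : Hypergraph n) (isGraph : IsGraph G) {κ : ℕ} (net : Network κ G)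
                (L : ListAssignment G) (p r : ℕ)
                {N s : ℕ} (V↔ : Line.V G isGraph net L p r ↔ Fin N) (E↔ : Line.E G isGraph net L p r ↔ Fin s)
                {M : Subset s} (maximal : Hypergraph.MaximalMatching
                  (Realization.hypergraph (Line.line G isGraph net L p r) V↔ E↔) M) where
  open Hypergraph G
  open Network net
  open ListAssignment L
  open Graph G isGraph net
  open Line G isGraph net L p r hiding (V↔; E↔; ident-length)
  open Realization line V↔ E↔

  open Hypergraph hypergraph using () renaming (ShareVertex to ShareVertexᴴ; edge to edgeᴴ)

  matching : Hypergraph.Matching hypergraph M
  matching = proj₁ maximal

  Chosen : E → Set
  Chosen g = toE g ∈ˢ M

  disjoint : ∀ {g h v} → Chosen g → Chosen h → Incident v g → Incident v h → g ≢ h → ⊥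
  disjoint g∈ h∈ v∈g v∈h g≢h = matching g∈ h∈ (g≢h ∘ toE-injective)
      (from ShareVertex⇔ (_ , from ∈-members v∈g , from ∈-members v∈h))

  -- If no chosen hyperedge met `g`, adding `g` to M would leave a matching, against maximality. The
  -- search over all hyperedges is finite, so an actual witness results.
  blocked : ∀ g → ¬ Chosen g → ∃[ h ] (Chosen h × ∃[ v ] (Incident v g × Incident v h))
  blocked g g∉ with Fin.any? (λ y → (y Subset.∈? M) ×-dec Subset.nonempty? (edgeᴴ (toE g) Subset.∩ edgeᴴ y))
  ... | yes (y , y∈ , share) = fromE y , subst (_∈ˢ M) (sym (toE-fromE y)) y∈ ,
      (let v , v∈g , v∈h = to ShareVertex⇔ (subst (ShareVertexᴴ (toE g)) (sym (toE-fromE y)) share) in v , to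
              ∈-members v∈g , to ∈-members v∈h)
  ... | no none = ⊥-elim (proj₂ maximal (toE g) g∉ extended)
    where
    share-sym : ∀ {x y} → ShareVertexᴴ x y → ShareVertexᴴ y x
    share-sym {x} {y} = subst Subset.Nonempty (Subset.∩-comm (edgeᴴ x) (edgeᴴ y))
    extended : Hypergraph.Matching hypergraph (M ∪ ⁅ toE g ⁆)
    extended {x} {y} x∈ y∈ x≢y share with Subset.x∈p∪q⁻ M ⁅ toE g ⁆ x∈ | Subset.x∈p∪q⁻ M ⁅ toE g ⁆ y∈
    ... | inj₁ x∈M | inj₁ y∈M = matching x∈M y∈M x≢y share
    ... | inj₁ x∈M | inj₂ y≡ with refl ← Subset.x∈⁅y⁆⇒x≡y (toE g) y≡ = none (x , x∈M , share-sym {x} {y} share)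
    ... | inj₂ x≡ | inj₁ y∈M with refl ← Subset.x∈⁅y⁆⇒x≡y (toE g) x≡ = none (y , y∈M , share)
    ... | inj₂ x≡ | inj₂ y≡ = x≢y (trans (Subset.x∈⁅y⁆⇒x≡y (toE g) x≡) (sym (Subset.x∈⁅y⁆⇒x≡y (toE g) y≡)))

  chosen-unique : ∀ {e} {k l : Slot e} → Chosen (inj₁ (e , k)) → Chosen (inj₁ (e , l)) → k ≡ l
  chosen-unique {e} {k} {l} k∈ l∈ with k Fin.≟ l
  ... | yes k≡l = k≡l
  ... | no k≢l  = ⊥-elim (disjoint {v = edgeᵛ e} k∈ l∈ refl refl (λ { refl → k≢l refl }))

  -- If no hyperedge (e , k) were chosen, each color of e would be taken by an
  -- adjacent edge, and different colors by different ones.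
  choice : ∀ e → ∃[ k ] Chosen (inj₁ (e , k))
  choice e with Fin.any? (λ k → toE (inj₁ (e , k)) Subset.∈? M)
  ... | yes found = found
  ... | no none   = ⊥-elim (ℕ.1+n≰n (subst (_≤ edgeDegree e) (colors-length e)
      (Fin.injective⇒≤ {f = thief} thief-injective)))
    where
    Taken : Slot e → Fin size → Set
    Taken k f = Adjacent e f × ∃[ l ] (Chosen (inj₁ (f , l)) × colorAt f l ≡ colorAt e k)
    taken : ∀ k → ∃[ f ] Taken k f
    taken k = steal (blocked (inj₁ (e , k)) (λ k∈ → none (k , k∈)))
      where
      steal : ∃[ h ] (Chosen h × ∃[ v ] (Incident v (inj₁ (e , k)) × Incident v h)) → ∃[ f ] Taken k f
      steal (inj₁ (f , l) , fl∈ , edgeᵛ _ , refl , refl) = ⊥-elim (none (l , fl∈))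
      steal (inj₁ (f , l) , fl∈ , colorᵛ u i , (u∈e , eq) , (u∈f , eq′)) =
        f , ((λ { refl → none (l , fl∈) }) , u , Subset.x∈p∩q⁺ (u∈e , u∈f)) , l , fl∈ , trans (sym eq′) eq
      steal (inj₂ q , _ , edgeᵛ _ , _ , ())
      steal (inj₂ q , _ , colorᵛ _ _ , _ , ())
      steal (inj₂ q , _ , inj₂ (inj₂ _) , () , _)
    adjacent∈ : ∀ k → proj₁ (taken k) ∈ filter (adjacent? e) (allFin size)
    adjacent∈ k = ∈-filter⁺ (adjacent? e) (∈-allFin _) (proj₁ (proj₂ (taken k)))
    thief : Slot e → Fin (edgeDegree e)
    thief k = Any.index (adjacent∈ k)
    same-slot : ∀ {k k′} (t : ∃[ f ] Taken k f) (t′ : ∃[ f ] Taken k′ f) → proj₁ t ≡ proj₁ t′ → k ≡ k′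
    same-slot (f , _ , l , l∈ , eq) (f , _ , l′ , l∈′ , eq′) refl =
      colorAt-injective (trans (sym eq) (trans (cong (colorAt f) (chosen-unique l∈ l∈′)) eq′))
    thief-injective : ∀ {k k′} → thief k ≡ thief k′ → k ≡ k′
    thief-injective {k} {k′} eq = same-slot (taken k) (taken k′) (trans (Any.lookup-index (adjacent∈ k))
      (trans (cong (lookup (filter (adjacent? e) (allFin size))) eq) (sym (Any.lookup-index (adjacent∈ k′)))))

  φ : Fin size → ℕ
  φ e = colorAt e (proj₁ (choice e))

  coloring : ListEdgeColoring φ
  coloring = (λ e → ∈-lookup (proj₁ (choice e))) , proper
    where
    proper : ∀ {e f} → Adjacent e f → φ e ≢ φ f
    proper {e} {f} (e≢f , u , u∈) eq =
      let u∈e , u∈f = Subset.x∈p∩q⁻ (edge e) (edge f) u∈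
          k , k∈ = choice e
          l , l∈ = choice f
      in disjoint {v = colorᵛ u (hueAt u∈e k)} k∈ l∈ (u∈e , hue-hueAt u∈e k) (u∈f , trans (hue-hueAt u∈e k) eq)
          (λ { refl → e≢f refl })

-- Decisions of the nodes

firstWith-unique : ∀ p l k → p (lookup l k) ≡ true → (∀ j → p (lookup l j) ≡ true → j ≡ k) →
    firstWith p l ≡ lookup l k
firstWith-unique p (c ∷ l) zero    pk only rewrite pk = refl
firstWith-unique p (c ∷ l) (suc k) pk only with p c in eq
... | true  = case only zero eq of λ ()
... | false = firstWith-unique p l k pk (λ j pj → Fin.suc-injective (only (suc j) pj))

is-just-witness : (m : Maybe A) → is-just m ≡ true → ∃[ x ] m ≡ just x
is-just-witness (just x) _ = x , refl

module Decision {I O : Set} (𝒜 : Algorithm I O) {κ n : ℕ} {H : Hypergraph n} (net : Network κ H)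
                (input : Fin (Hypergraph.size H) → I) where
  open Algorithm 𝒜
  open Execution 𝒜 net input

  decision-mono : ∀ {t T v os} → t ≤ T → decision t v ≡ just os → decision T v ≡ just os
  decision-mono t≤T = go (ℕ.≤⇒≤′ t≤T)
    where
    go : ∀ {t T v os} → t ≤′ T → decision t v ≡ just os → decision T v ≡ just os
    go ≤′-refl eq = eq
    go {T = suc T} {v} (≤′-step t≤T) eq = cong (_<∣> output (state (suc T) v)) (go t≤T eq)

  -- If a node is always either silent or right, its first output is right, whenever it comes. The
  -- current output is carried along so that a node that speaks at T cannot still be undecided.
  decision-cases : ∀ {T v os} → (∀ {t} → t ≤ T → output (state t v) ≡ nothing ⊎ output (state t v) ≡ just os) →
                   (decision T v ≡ nothing × output (state T v) ≡ nothing) ⊎ decision T v ≡ just os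
  decision-cases {zero}  cases = Sum.map₁ (λ eq → eq , eq) (cases z≤n)
  decision-cases {suc T} cases with decision-cases {T} (cases ∘ ℕ.m≤n⇒m≤1+n)
  ... | inj₁ (eq , _) rewrite eq = Sum.map₁ (λ eq → eq , eq) (cases ℕ.≤-refl)
  ... | inj₂ eq rewrite eq = inj₂ refl

  decision-at : ∀ {T v os} → (∀ {t} → t ≤ T → output (state t v) ≡ nothing ⊎ output (state t v) ≡ just os) →
                output (state T v) ≡ just os → decision T v ≡ just os
  decision-at {T} cases now with decision-cases {T} cases
  ... | inj₁ (_ , ≡nothing) = case trans (sym now) ≡nothing of λ ()
  ... | inj₂ eq             = eq

module Solution {n : ℕ} (G : Hypergraph n) (isGraph : IsGraph G) {κ : ℕ} (net : Network κ G)
                (L : ListAssignment G) (p r : ℕ)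
                {N s κ′ : ℕ} (V↔ : Line.V G isGraph net L p r ↔ Fin N) (E↔ : Line.E G isGraph net L p r ↔ Fin s)
                (ident-length : ∀ v → bitLength (Line.ident G isGraph net L p r v) ≤ κ′ * ⌈log₂ N ⌉)
                (𝒜 : Algorithm ⊤ Bool) where
  open Hypergraph G
  open Network net
  open ListAssignment L
  open Graph G isGraph net
  open Line G isGraph net L p r hiding (V↔; E↔; ident-length)
  open Realization line V↔ E↔
  open Labelled κ′ ident ident-injective ident-length
  open Simulation 𝒜
  open Local
  open Correctness G isGraph net L p r {κ′ = κ′} V↔ E↔ ident-length 𝒜

  picks≡ : ∀ s (φ : Fin size → ℕ) {es} a → Unique es →
           (∀ {e} → e ∈ es → firstWith (chosen s (a + position e es)) (colors e) ≡ φ e) →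
               picks s a (map colors es) ≡ map φ es
  picks≡ s φ {[]}     a u eq = refl
  picks≡ s φ {e ∷ es} a (e∉ ∷ u) eq = cong₂ _∷_
    (trans (cong (λ j → firstWith (chosen s j) (colors e))
        (trans (sym (ℕ.+-identityʳ a)) (cong (a +_) (sym (position-here e es))))) (eq (here refl)))
    (picks≡ s φ (suc a) u λ {f} f∈ → trans (cong (λ j → firstWith (chosen s j) (colors f))
      (trans (sym (ℕ.+-suc a (position f es)))
          (cong (a +_) (sym (position-there es (≢-sym (All.lookup e∉ f∈))))))) (eq (there f∈)))

  module _ {T : ℕ} {M : Subset s} (maximal : Hypergraph.MaximalMatching hypergraph M)
           (outputs : 𝒜-run.OutputsWithin T (Vec.lookup M)) where
    open Coloring G isGraph net L p r V↔ E↔ maximal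

    -- Decisions never change, so a vertex that decides before round T has already announced its
    -- part of M.
    decided-final : ∀ {t u i bs} → t ≤ T → decided (local t u) (hue u i) ≡ just bs →
                    bs ≡ map (Vec.lookup M) (map toE (inc (colorᵛ u i)))
    decided-final {t} {u} {i} t≤T eq = just-injective (trans
      (sym (Decision.decision-mono 𝒜 network (λ _ → tt) t≤T (trans (sym (decided≡ t u i)) eq)))
      (trans (outputs (toV (colorᵛ u i))) (cong (just ∘ map (Vec.lookup M)) (incident-toV (colorᵛ u i)))))

    chosen≡ : ∀ {t u i e k} → u ∈ˢ edge e → hue u i ≡ colorAt e k → t ≤ T →
        is-just (decided (local t u) (hue u i)) ≡ true →
              chosen (local t u) (position e (incident u)) (hue u i) ≡ Vec.lookup M (toE (inj₁ (e , k)))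
    chosen≡ {t} {u} {i} {e} {k} u∈ eq t≤T ready =
      let bs , dec≡ = is-just-witness (decided (local t u) (hue u i)) ready in
      trans (cong (maybe′ (λ bs → at false bs
          (localRank (hue u i) (position e (incident u)) (inputs (local t u)))) false) dec≡)
        (trans (cong₂ (at false) (decided-final {t} {u} {i} t≤T dec≡)
                 (trans (cong (localRank (hue u i) (position e (incident u))) (inputs-local t u))
                     (sym (port-colorᵛ u∈ eq))))
          (at-position false (Vec.lookup M) (∈-map⁺ toE (from inc-complete (from ∈-members (u∈ , eq))))))

    -- When u is ready, the bits that it holds for an edge are those of M, and exactly one color of
    -- the edge is marked. Hence the two endpoints name the same color even if they become ready in
    -- different rounds.
    result-solution : ∀ {t u} → t ≤ T → Ready (local t u) → result (local t u) ≡ just (map φ (incident u))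
    result-solution {t} {u} t≤T ready = trans (result-ready ready)
      (cong just (trans (cong (picks (local t u) 0) (inputs-local t u))
          (picks≡ (local t u) φ 0 (incident-unique u) pick)))
      where
      isReady : ∀ i → is-just (decided (local t u) (hue u i)) ≡ true
      isReady i = All.lookup ready (subst (λ ls → hue u i ∈ palette ls) (sym (inputs-local t u))
          (∈-lookup {xs = hues u} i))
      pick : ∀ {e} → e ∈ incident u → firstWith (chosen (local t u) (position e (incident u))) (colors e) ≡ φ e
      pick {e} e∈ = firstWith-unique (chosen (local t u) (position e (incident u))) (colors e)
          (proj₁ (choice e))
          (trans (chosenAt (proj₁ (choice e))) (Vec.[]=⇒lookup (proj₂ (choice e))))
          λ l pl → chosen-unique (Vec.lookup⇒[]= (toE (inj₁ (e , l))) M (trans (sym (chosenAt l)) pl))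
              (proj₂ (choice e))
        where
        u∈ : u ∈ˢ edge e
        u∈ = to (incident-complete u e) e∈
        chosenAt : ∀ l → chosen (local t u) (position e (incident u)) (colorAt e l) ≡ Vec.lookup M
            (toE (inj₁ (e , l)))
        chosenAt l = trans (cong (chosen (local t u) (position e (incident u))) (sym (hue-hueAt u∈ l)))
          (chosen≡ {t} {u} {hueAt u∈ l} u∈ (hue-hueAt u∈ l) t≤T (isReady (hueAt u∈ l)))

    ready-at-end : ∀ u → Ready (local T u)
    ready-at-end u = All.tabulate λ {c} c∈ →
      let c∈′ = subst (λ ls → c ∈ palette ls) (inputs-local T u) c∈
          i   = Any.index c∈′
      in subst (λ c → is-just (decided (local T u) c) ≡ true) (sym (Any.lookup-index c∈′))
           (cong is-just (trans (decided≡ T u i) (outputs (toV (colorᵛ u i)))))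

    solution : Σ[ ψ ∈ (Fin size → ℕ) ] (ListEdgeColoring ψ × ℬ-run.OutputsWithin T ψ)
    solution = φ , coloring , λ u → Decision.decision-at ℬ net colors {T} {u}
      (λ {t} t≤T → case ready? (local t u) of λ
        { (yes ready)  → inj₂ (result-solution {t} t≤T ready)
        ; (no unready) → inj₁ (result-unready unready) })
      (result-solution ℕ.≤-refl (ready-at-end u))

-- Rank, maximum degree and number of vertices

length-rays≤ : ∀ {p} (q : Fin p) → length (rays q) ≤ p
length-rays≤ {p} zero    = ℕ.≤-reflexive (length-tabulate {n = p} id)
length-rays≤ {p} (suc _) = s≤s z≤n

centre : ∀ {p} → 1 ≤ p → ∃[ q ] length (rays {p} q) ≡ p
centre {p} (s≤s _) = zero , length-tabulate {n = p} id

module Reduction {n : ℕ} (G : Hypergraph n) (isGraph : IsGraph G) {κ : ℕ} (net : Network κ G)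
                 (L : ListAssignment G) (p r : ℕ)
                 {N s κ′ : ℕ} (V↔ : Line.V G isGraph net L p r ↔ Fin N)
                     (E↔ : Line.E G isGraph net L p r ↔ Fin s)
                 (ident-length : ∀ v → bitLength (Line.ident G isGraph net L p r v) ≤ κ′ * ⌈log₂ N ⌉) where
  open Hypergraph G using (size; maxDegree)
  open Network net
  open ListAssignment L
  open Graph G isGraph net
  open Line G isGraph net L p r hiding (V↔; E↔; ident-length)
  open Realization line V↔ E↔
  open Labelled κ′ ident ident-injective ident-length

  rank≡3 : ∀ e → Slot e → Hypergraph.rank hypergraph ≡ 3
  rank≡3 e k = rank-realized members≤3 (inj₁ (e , k)) refl
    where
    members≤3 : ∀ g → length (members g) ≤ 3
    members≤3 (inj₁ _)       = ℕ.≤-refl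
    members≤3 (inj₂ zero)    = s≤s z≤n
    members≤3 (inj₂ (suc _)) = s≤s (s≤s z≤n)

  length-inc-edgeᵛ : ∀ e → length (inc (edgeᵛ e)) ≡ length (colors e)
  length-inc-edgeᵛ e = trans (length-map {B = E} (λ k → inj₁ (e , k)) (allFin (length (colors e))))
      (length-tabulate {n = length (colors e)} id)

  -- An edge vertex lies in one hyperedge per color of its list, a color vertex in at most one per
  -- edge of its owner, and a star vertex in at most p.
  inc≤ : ∀ {d} → (∀ e → length (colors e) ≤ d) → maxDegree ≤ d → p ≤ d → ∀ v → length (inc v) ≤ d
  inc≤ colors≤d Δ≤d p≤d (edgeᵛ e)    = ℕ.≤-trans (ℕ.≤-reflexive (length-inc-edgeᵛ e)) (colors≤d e)
  inc≤ colors≤d Δ≤d p≤d (colorᵛ u i) =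
      ℕ.≤-trans (ℕ.≤-reflexive (length-map inj₁ (choices (hue u i) (incident u))))
    (ℕ.≤-trans (length-choices≤ (hue u i) (incident u)) (ℕ.≤-trans (length-incident≤ u) Δ≤d))
  inc≤ colors≤d Δ≤d p≤d (padᵛ q)     =
      ℕ.≤-trans (ℕ.≤-reflexive (length-map inj₂ (rays q))) (ℕ.≤-trans (length-rays≤ q) p≤d)
  inc≤ colors≤d Δ≤d p≤d (idleᵛ _)    = z≤n

  full : ∀ {d} → 1 ≤ d → (∃[ e ] length (colors e) ≡ d) ⊎ p ≡ d → ∃[ v ] length (inc v) ≡ d
  full 1≤d (inj₁ (e , eq)) = edgeᵛ e , trans (length-inc-edgeᵛ e) eq
  full 1≤d (inj₂ refl)     = let q , eq = centre 1≤d in padᵛ q , trans (length-map inj₂ (rays q)) eq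

  solve-via-matching : (𝒜 : Algorithm ⊤ Bool) {d : ℕ} (T : ℕ) (e : Fin size) → Slot e → 1 ≤ d →
    (∀ e → length (colors e) ≤ d) → maxDegree ≤ d → p ≤ d → (∃[ e ] length (colors e) ≡ d) ⊎ p ≡ d →
    ComputesMaximalMatching κ′ 𝒜 N 3 d T →
    Σ[ ψ ∈ (Fin size → ℕ) ] (ListEdgeColoring ψ × Execution.OutputsWithin (Simulation.ℬ 𝒜) net colors T ψ)
  solve-via-matching 𝒜 T e k 1≤d colors≤d Δ≤d p≤d attained computes =
    let v , v-full = full 1≤d attained
        M , maximal , outputs = computes hypergraph (rank≡3 e k)
            (maxDegree-realized (inc≤ colors≤d Δ≤d p≤d) v v-full) network
    in Solution.solution G isGraph net L p r {κ′ = κ′} V↔ E↔ ident-length 𝒜 {T} maximal outputs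

solve-within : (𝒜 : Algorithm ⊤ Bool) {n : ℕ} (G : Hypergraph n) (isGraph : IsGraph G) {κ : ℕ}
    (net : Network κ G)
  (L : ListAssignment G) {N d : ℕ} (T p : ℕ) →
  let open Hypergraph G; open ListAssignment L in
  Fin size → (∀ e → length (colors e) ≤ d) → maxDegree ≤ d → p ≤ d → (∃[ e ] length (colors e) ≡ d) ⊎ p ≡ d →
  size + (Line.spread G isGraph net L p 0 + p) ≤ N → 2 * n ≤ N →
  ComputesMaximalMatching (4 * κ + 10) 𝒜 N 3 d T →
  Σ[ ψ ∈ (Fin size → ℕ) ] (ListEdgeColoring ψ × Execution.OutputsWithin (Simulation.ℬ 𝒜) net colors T ψ)
solve-within 𝒜 {n} G isGraph {κ} net L {N} T p e₀ colors≤d Δ≤d p≤d attained fits 2n≤N =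
  Reduction.solve-via-matching G isGraph net L p r {κ′ = 4 * κ + 10}
    (subst (λ N → V ↔ Fin N) N≡ (Line.V↔ G isGraph net L p r)) (Line.E↔ G isGraph net L p r)
    (Line.ident-length G isGraph net L p r N≡ 2n≤N (ℕ.<⇒≤ (2≤n e₀)))
    -- A list of length d_e + 1 is nonempty, so some hyperedge has three vertices and the rank is
    -- exactly 3.
    𝒜 T e₀ (subst Fin (sym (colors-length e₀)) zero) (ℕ.≤-trans (1≤maxDegree e₀) Δ≤d) colors≤d Δ≤d p≤d attained
  where
  open Hypergraph G using (size)
  open ListAssignment L
  open Graph G isGraph net
  r : ℕ
  -- The palettes do not depend on the number of idle vertices. Taking `spread` from the instance
  -- with none of them avoids a circular definition, and both values agree by computation.
  r = N ∸ (size + (Line.spread G isGraph net L p 0 + p))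
  open Line G isGraph net L p r using (V; spread)
  N≡ : size + (spread + (p + r)) ≡ N
  N≡ = trans (cong (size +_) (sym (ℕ.+-assoc spread p r)))
      (trans (sym (ℕ.+-assoc size (spread + p) r)) (ℕ.m+[n∸m]≡n fits))

spread≤ : ∀ {n} (G : Hypergraph n) (isGraph : IsGraph G) {κ : ℕ} (net : Network κ G)
    (L : ListAssignment G) p r {b} →
  (∀ e → length (ListAssignment.colors L e) ≤ b) →
      Line.spread G isGraph net L p r ≤ n * (Hypergraph.maxDegree G * b)
spread≤ G isGraph net L p r {b} colors≤b = total-≤ λ u →
  ℕ.≤-trans (length-deduplicate ℕ._≟_ (concatMap colors (incident u)))
    (ℕ.≤-trans (length-concatMap-≤ {f = colors} {xs = incident u} (λ {e} _ → colors≤b e))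
        (ℕ.*-monoˡ-≤ b (length-incident≤ u)))
  where
  open Network net
  open ListAssignment L
  open Graph G isGraph net

slots≤ : ∀ {n Δ m s p b} → m ≤ n * Δ → s ≤ n * (Δ * b) → n * Δ + (n * (Δ * b) + p) ≤ 2 * n * Δ ^ 2 →
    m + (s + p) ≤ 2 * n * Δ ^ 2
slots≤ {p = p} m≤ s≤ = ℕ.≤-trans (ℕ.+-mono-≤ m≤ (ℕ.+-monoˡ-≤ p s≤))

-- The origin of 2nΔ²: nΔ bounds the edge vertices and nΔ (2Δ - 1) the color vertices, and the sum
-- is an equality, which leaves no guaranteed room for a star.
slots-full : ∀ n {Δ} → 1 ≤ Δ → n * Δ + (n * (Δ * (2 * Δ ∸ 1)) + 0) ≤ 2 * n * Δ ^ 2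
slots-full n {suc δ} _ = ℕ.≤-reflexive (solve 2 (λ n δ →
    n :* (con 1 :+ δ) :+ (n :* ((con 1 :+ δ) :* (δ :+ (con 1 :+ (δ :+ con 0)))) :+ con 0)
    := con 2 :* n :* ((con 1 :+ δ) :* ((con 1 :+ δ) :* con 1))) refl n δ)
  where open +-*-Solver

-- If no list is full, n Δ vertices are spare, and 2 Δ ∸ 1 ≤ n Δ since n ≥ 2.
slots-padded : ∀ n {Δ} → 1 ≤ Δ → 2 ≤ n → n * Δ + (n * (Δ * (2 * Δ ∸ 2)) + (2 * Δ ∸ 1)) ≤ 2 * n * Δ ^ 2
slots-padded n {suc δ} _ 2≤n = begin
  n * suc δ + (n * (suc δ * (2 * suc δ ∸ 2)) + (2 * suc δ ∸ 1))
    ≤⟨ ℕ.+-monoʳ-≤ (n * suc δ) (ℕ.+-mono-≤ (ℕ.≤-reflexive (cong (λ b → n * (suc δ * b)) even))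
        (ℕ.≤-trans (ℕ.m∸n≤m (2 * suc δ) 1) (ℕ.*-monoˡ-≤ (suc δ) 2≤n))) ⟩
  n * suc δ + (n * (suc δ * (δ + δ)) + n * suc δ)
    ≡⟨ solve 2 (λ n δ → n :* (con 1 :+ δ) :+ (n :* ((con 1 :+ δ) :* (δ :+ δ)) :+ n :* (con 1 :+ δ))
         := con 2 :* n :* ((con 1 :+ δ) :* ((con 1 :+ δ) :* con 1))) refl n δ ⟩
  2 * n * suc δ ^ 2 ∎
  where
  open ℕ.≤-Reasoning
  open +-*-Solver
  even : 2 * suc δ ∸ 2 ≡ δ + δ
  even = trans (cong (_∸ 1) (ℕ.+-suc δ (δ + 0))) (cong (δ +_) (ℕ.+-identityʳ δ))

ℬ-solves : (𝒜 : Algorithm ⊤ Bool) {n : ℕ} (G : Hypergraph n) → IsGraph G →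
    {κ : ℕ} (net : Network κ G) (L : ListAssignment G) (T : ℕ → ℕ → ℕ) →
  let open Hypergraph G; open ListAssignment L in
  Fin size → (∀ N d → ComputesMaximalMatching (4 * κ + 10) 𝒜 N 3 d (T N d)) →
  Σ[ ψ ∈ (Fin size → ℕ) ] (ListEdgeColoring ψ × Execution.OutputsWithin (Simulation.ℬ 𝒜) net colors
      (T (2 * n * maxDegree ^ 2) (2 * maxDegree ∸ 1)) ψ)
ℬ-solves 𝒜 {n} G isGraph {κ} net L T e₀ computes = by-cases (Fin.any? (λ e → length (colors e) ℕ.≟ d))
  where
  open Hypergraph G
  open ListAssignment L
  open Graph G isGraph net
  d : ℕ
  d = 2 * maxDegree ∸ 1
  1≤Δ : 1 ≤ maxDegree
  1≤Δ = 1≤maxDegree e₀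
  colors≤d : ∀ e → length (colors e) ≤ d
  colors≤d e = ℕ.≤-trans (ℕ.≤-reflexive (colors-length e)) (edgeDegree< e)
  Δ≤d : maxDegree ≤ d
  Δ≤d = ℕ.≤-trans (ℕ.m≤m+n maxDegree (maxDegree ∸ 1))
      (ℕ.≤-reflexive (trans (sym (ℕ.+-∸-assoc maxDegree 1≤Δ))
      (cong (λ k → maxDegree + k ∸ 1) (sym (ℕ.+-identityʳ maxDegree)))))
  2n≤N : 2 * n ≤ 2 * n * maxDegree ^ 2
  2n≤N = ℕ.≤-trans (ℕ.≤-reflexive (sym (ℕ.*-identityʳ (2 * n)))) (ℕ.*-monoʳ-≤ (2 * n) (ℕ.^-monoˡ-≤ 2 1≤Δ))
  -- Only the analysis distinguishes the cases. The simulating algorithm is the same in both, and no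
  -- node has to know whether some list is full.
  by-cases : Dec (∃[ e ] length (colors e) ≡ d) →
    Σ[ ψ ∈ (Fin size → ℕ) ] (ListEdgeColoring ψ × Execution.OutputsWithin (Simulation.ℬ 𝒜) net colors
        (T (2 * n * maxDegree ^ 2) d) ψ)
  by-cases (yes attained) = solve-within 𝒜 G isGraph net L (T (2 * n * maxDegree ^ 2) d) 0 e₀ colors≤d Δ≤d z≤n
      (inj₁ attained)
    (slots≤ {n} {maxDegree} size≤ (spread≤ G isGraph net L 0 0 colors≤d) (slots-full n 1≤Δ)) 2n≤N (computes _ _)
  by-cases (no none) = solve-within 𝒜 G isGraph net L (T (2 * n * maxDegree ^ 2) d) d e₀ colors≤d Δ≤d ℕ.≤-refl
      (inj₂ refl)
    (slots≤ {n} {maxDegree} size≤ (spread≤ G isGraph net L d 0 colors<d) (slots-padded n 1≤Δ (2≤n e₀))) 2n≤N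
        (computes _ _)
    where
    colors<d : ∀ e → length (colors e) ≤ 2 * maxDegree ∸ 2
    colors<d e = ℕ.≤-trans (ℕ.∸-monoˡ-≤ 1 (ℕ.≤∧≢⇒< (colors≤d e) (λ eq → none (e , eq))))
        (ℕ.≤-reflexive (ℕ.∸-+-assoc (2 * maxDegree) 1 1))

-- Without edges Δ = 0, and no hypergraph on 2nΔ² = 0 vertices has rank 3, so the reduction cannot
-- be set up. Instead, all palettes are empty and every node is ready in round 0.
edgeless : (𝒜 : Algorithm ⊤ Bool) {n : ℕ} (G : Hypergraph n) {κ : ℕ} (net : Network κ G)
    (L : ListAssignment G) → ¬ Fin (Hypergraph.size G) → ∀ T →
  let open Hypergraph G; open ListAssignment L in
  Σ[ ψ ∈ (Fin size → ℕ) ] (ListEdgeColoring ψ × Execution.OutputsWithin (Simulation.ℬ 𝒜) net colors T ψ)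
edgeless 𝒜 G net L empty T = (λ _ → 0) , ((λ e → ⊥-elim (empty e)) , (λ {e} → ⊥-elim (empty e))) ,
  λ u → trans (Decision.decision-mono ℬ net colors {0} {T} {u} z≤n (immediate u))
      (cong (just ∘ map _) (sym (isolated u)))
  where
  open Hypergraph G
  open Network net
  open ListAssignment L
  open Simulation 𝒜
  isolated : ∀ u → incident u ≡ []
  isolated u with incident u
  ... | []    = refl
  ... | e ∷ _ = ⊥-elim (empty e)
  immediate : ∀ u → result (Execution.state ℬ net colors 0 u) ≡ just []
  immediate u rewrite isolated u = refl

lemma2p13 : ∀ (κ : ℕ) → ∃[ κ′ ]
    ((T : ℕ → ℕ → ℕ) (𝒜 : Algorithm ⊤ Bool) →
    (∀ N d → ComputesMaximalMatching κ′ 𝒜 N 3 d (T N d)) →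
    Σ[ ℬ ∈ Algorithm (List ℕ) ℕ ]
    (∀ n Δ → SolvesListEdgeColoring κ ℬ n Δ (T (2 * n * Δ ^ 2) (2 * Δ ∸ 1))))
-- The constant comes from `ident-length` and depends on κ alone, so it can be fixed before 𝒜. The
-- search asks whether there is any edge.
lemma2p13 κ = 4 * κ + 10 , λ T 𝒜 computes → Simulation.ℬ 𝒜 , λ { n Δ G isGraph refl L net →
  case Fin.any? (λ (e : Fin (Hypergraph.size G)) → yes tt) of λ
    { (yes (e₀ , _)) → ℬ-solves 𝒜 G isGraph net L T e₀ computes
    ; (no none)      → edgeless 𝒜 G net L (λ e → none (e , tt))
        (T (2 * n * Hypergraph.maxDegree G ^ 2) (2 * Hypergraph.maxDegree G ∸ 1)) } }
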